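{- Let $k\ge 1$ and $0<\varepsilon<1/2$. There is a relative-error $\varepsilon$-testing algorithm for the class of $k$-juntas over $\{0,1\}^n$ that makes $O\big((k/\varepsilon)\log(k/\varepsilon)\big)$ total calls to its oracles (membership queries and random satisfying-assignment samples).
   Context: A function $f:\{0,1\}^n\to\{0,1\}$ is a $k$-junta if it depends on at most $k$ of its $n$ input variables. For $f,g:\{0,1\}^n\to\{0,1\}$ with $f^{ -1}(1)\neq\emptyset$, the relative distance is $\mathrm{rel\text{ - }dist}(f,g)=|f^{ -1}(1)\,\triangle\, g^{ -1}(1)|/|f^{ -1}(1)|$, and for a class $\mathcal{C}$, $\mathrm{rel\text{ - }dist}(f,\mathcal{C})=\min_{g\in\mathcal{C}}\mathrm{rel\text{ - }dist}(f,g)$. A relative-error $\varepsilon$-testing algorithm for $\mathcal{C}$ is given black-box query access to the unknown $f$ (it may query $f(x)$ for any $x$) and access to an oracle returning independent uniformly random elements of $f^{ -1}(1)$; it must output "accept" with probability at least $2/3$ if $f\in\mathcal{C}$, and output "reject" with probability at least $2/3$ if $\mathrm{rel\text{ - }dist}(f,\mathcal{C})\ge\varepsilon$. -}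

module Defs where

open import Data.Bool using (Bool; true; false; if_then_else_; _xor_)
open import Data.Nat as ℕ using (ℕ; zero; suc; _⊔_; _≤_)
open import Data.Nat.DivMod using (_/_)
open import Data.Nat.Logarithm using (⌈log₂_⌉)
open import Data.Integer as ℤ using (+_)
open import Data.Rational as ℚ using (ℚ; 0ℚ; 1ℚ; ½; ↥_; ↧ₙ_)
open import Data.List using (List; []; _∷_; map; concatMap; length; filterᵇ; foldr)
open import Data.Vec using (Vec; []; _∷_; lookup)
open import Data.Fin using (Fin)
open import Data.Fin.Subset using (Subset; _∈_; ∣_∣)
open import Data.Product using (Σ; _×_; ∃-syntax)
open import Relation.Binary.PropositionalEquality using (_≡_)

Cube : ℕ → Set
Cube n = Vec Bool n

BoolFun : ℕ → Set
BoolFun n = Cube n → Bool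

allPoints : (n : ℕ) → List (Cube n)
allPoints zero = [] ∷ []
allPoints (suc n) = concatMap (λ x → (false ∷ x) ∷ (true ∷ x) ∷ []) (allPoints n)

ones : ∀ {n} → BoolFun n → List (Cube n)
ones {n} f = filterᵇ f (allPoints n)

weight : ∀ {n} → BoolFun n → ℕ
weight f = length (ones f)

Nonempty : ∀ {n} → BoolFun n → Set
Nonempty {n} f = ∃[ x ] (f x ≡ true)

IsJunta : ∀ {n} → ℕ → BoolFun n → Set
IsJunta {n} k f =
  Σ (Subset n) λ S → (∣ S ∣ ≤ k) ×
    (∀ (x y : Cube n) → (∀ (i : Fin n) → i ∈ S → lookup x i ≡ lookup y i) → f x ≡ f y)

-- rational fraction a / d (defined as 0 when d = 0; only used with d > 0)

frac : ℕ → ℕ → ℚ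
frac a zero = 0ℚ
frac a (suc d) = (+ a) ℚ./ suc d

relDist : ∀ {n} → BoolFun n → BoolFun n → ℚ
relDist {n} f g =
  frac (length (filterᵇ (λ x → f x xor g x) (allPoints n))) (weight f)

-- Randomized relative-error testing algorithms, as (adaptive) randomized
-- decision trees over the two oracles plus internal fair coins.

data Alg (n : ℕ) : Set where
  halt   : Bool → Alg n
  query  : Cube n → (Bool → Alg n) → Alg n
  -- sampling oracle: receive a uniform random element of f^{-1}(1)
  sample : (Cube n → Alg n) → Alg n
  coin   : (Bool → Alg n) → Alg n

maxList : List ℕ → ℕ
maxList = foldr _⊔_ 0

calls : ∀ {n} → Alg n → ℕ
calls (halt b) = 0
calls (query x t) = suc (calls (t false) ⊔ calls (t true))
calls {n} (sample t) = suc (maxList (map (λ x → calls (t x)) (allPoints n)))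
calls (coin t) = calls (t false) ⊔ calls (t true)

sumℚ : List ℚ → ℚ
sumℚ = foldr ℚ._+_ 0ℚ

avg : List ℚ → ℚ
avg [] = 0ℚ
avg (p ∷ ps) = frac 1 (length (p ∷ ps)) ℚ.* sumℚ (p ∷ ps)

accProb : ∀ {n} → BoolFun n → Alg n → ℚ
accProb f (halt b) = if b then 1ℚ else 0ℚ
accProb f (query x t) = accProb f (t (f x))
accProb f (sample t) = avg (map (λ x → accProb f (t x)) (ones f))
accProb f (coin t) = ½ ℚ.* (accProb f (t false) ℚ.+ accProb f (t true))

twoThirds : ℚ
twoThirds = (+ 2) ℚ./ 3

ceilDiv : ℕ → ℕ → ℕ
ceilDiv a zero = 0
ceilDiv a (suc d) = (a ℕ.+ d) / suc d

-- ⌈k / ε⌉ for a positive rational ε = p/q : ⌈k q / p⌉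
ceilKOverEps : ℕ → ℚ → ℕ
ceilKOverEps k ε = ceilDiv (k ℕ.* ↧ₙ ε) ℤ.∣ ↥ ε ∣

bound : ℕ → ℚ → ℕ
bound k ε = ceilKOverEps k ε ℕ.* ⌈log₂ ceilKOverEps k ε ⌉

{-# OPTIONS --safe #-}

-- Write ⊕ for flipping and ∩ for restricting to a set of variables.  For x uniform in f⁻¹(1) and a
-- uniformly random set Z of variables, f is close to a junta on S iff f (x ⊕ (Z ∖ S)) is almost
-- surely 1 (majority vote over the variables outside S).
--
-- Labelling the variables with O(log k) random bits, a flip x ⊕ w with f (x ⊕ w) = 0 is refined by
-- binary search on the bits to a block X of equally labelled variables and a point v such that f
-- is not constant on v ⊕ (_ ∩ X).  If f is a k-junta, its relevant variables probably get distinct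
-- labels, so each block contains exactly one of them and f is a literal there; at most k blocks are
-- found in O(k/ε) attempts, hence at the end a random flip outside the blocks rarely leaves f⁻¹(1).
--
-- To flip a random set missing the (unknown) relevant variable τ of each block, query whether a random
-- Z contains τ and if so replace Z ∩ X by X ∖ Z; O(log (k/ε)) random checks that f does not depend on
-- the part claimed to miss τ make a wrong answer improbable.  The only structural fact needed when f is
-- arbitrary is: if for most Z one of Z, ∁ Z has small influence, then almost all the influence sits
-- on a single variable, because the sets carrying almost all the influence form an ultrafilter.
module Submission where

open import Defs

-- The two directions meet only in the list of blocks. Soundness treats that list as adversarial:
-- the rounds run on it are independent, so it is enough that one round rejects with probability at
-- least ε/8. Completeness treats the checks as exact: a literal never fails one, so a junta is lost
-- only through colliding labels or through influence left outside the blocks, and each of the two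
-- is allowed 1/6. The obstacle is that τ is never learned, so a set missing the unknown pivots
-- cannot be sampled directly. Replacing `Z` by its complement inside the cells where it hits gives
-- exactly the required distribution. A wrong answer is not corrected; it only becomes unlikely to
-- survive the checks, and the survival probabilities of at most k blocks must add up to less than
-- the ε/4 guaranteed by distance. A logarithm enters each phase once: O(k/ε) searches over O(log
-- (k/ε)) label bits, and O(1/ε) rounds with O(log (k/ε)) checks for each of at most k blocks.

module JuntaTester where

  open import Data.Bool using (Bool; true; false; T; if_then_else_; _xor_; not) renaming (_∧_ to _∧ᵇ_; _∨_ to _∨ᵇ_)
  import Data.Bool.Properties as 𝔹
  open import Data.Empty using (⊥-elim)
  open import Data.Fin using (Fin; zero; suc)
  import Data.Fin.Properties as Fin
  open import Data.Fin.Subset using (Subset; _∩_; _∪_; ∁; ⊤; ⁅_⁆; ∣_∣) renaming (⊥ to ∅; _∈_ to _∈ₛ_)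
  import Data.Fin.Subset.Properties as Subset
  open import Data.Integer as ℤ using ()
  import Data.Integer.Properties as ℤ
  open import Data.List using (List; []; _∷_; map; concatMap; length; filterᵇ)
  open import Data.List.Properties using (length-map)
  open import Data.List.Relation.Unary.All using (All; []; _∷_)
  open import Data.Nat as ℕ using (ℕ; zero; suc; s≤s; z≤n)
  import Data.Nat.DivMod as ℕ
  import Data.Nat.Induction as ℕ
  open import Data.Nat.Logarithm using (⌈log₂_⌉; ⌈log₂⌉-mono-≤; ⌈log₂⌈n/2⌉⌉≡⌈log₂n⌉∸1)
  import Data.Nat.Properties as ℕ
  import Data.Nat.Tactic.RingSolver as ℕ
  open import Data.Product using (Σ; _×_; _,_; proj₁; proj₂; ∃-syntax)
  open import Data.Rational hiding (truncate; ∣_∣)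
  open import Data.Rational.Properties
  open import Data.Rational.Unnormalised as ℚᵘ using (mkℚᵘ; *≡*)
  import Data.Rational.Unnormalised.Properties as ℚᵘ
  open import Data.Sum using (_⊎_; inj₁; inj₂)
  import Data.Unit
  open import Data.Unit using (tt)
  open import Data.Vec as Vec using (Vec; []; _∷_; lookup; zipWith)
  import Data.Vec.Properties as Vec
  open import Function using (_∘_)
  open import Level using (0ℓ)
  open import Relation.Binary.PropositionalEquality using (_≡_; _≢_; refl; sym; trans; cong; cong₂; subst; subst₂)
  open import Relation.Nullary using (¬_; Dec; yes; no; contradiction)
  open import Relation.Nullary.Decidable using (dec⇒maybe; does; toWitness; _×-dec_)
  open import Tactic.RingSolver using (solve-∀)
  import Tactic.RingSolver.Core.AlmostCommutativeRing as ACR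

  -- Rational arithmetic and finite expectations

  ℚ-ring : ACR.AlmostCommutativeRing 0ℓ 0ℓ
  ℚ-ring = ACR.fromCommutativeRing +-*-commutativeRing λ x → dec⇒maybe (0ℚ ≟ x)

  -- Linear arithmetic by certificate: the identity says that `q - p` equals `b - a`. With `a ≤ b`
  -- assembled from known inequalities, what remains is usually a task for the ring solver.
  ≤-by : ∀ {p q a b} → a ≤ b → p + b ≡ q + a → p ≤ q
  ≤-by {p} {q} {a} {b} a≤b eq = subst₂ _≤_ (shift p b) (shift q b)
    (+-monoˡ-≤ (- b) (≤-trans (≤-reflexive eq) (+-monoʳ-≤ q a≤b)))
    where
    shift : ∀ x y → (x + y) + - y ≡ x
    shift = solve-∀ ℚ-ring

  p≤q⇒0≤q-p : ∀ {p q} → p ≤ q → 0ℚ ≤ q - p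
  p≤q⇒0≤q-p {p} {q} p≤q = ≤-by p≤q (step p q)
    where
    step : ∀ p q → 0ℚ + q ≡ (q - p) + p
    step = solve-∀ ℚ-ring

  scale-≤ : ∀ {c a b} → 0ℚ ≤ c → a ≤ b → c * a ≤ c * b
  scale-≤ {c} 0≤c = *-monoˡ-≤-nonNeg c {{nonNegative 0≤c}}

  0≤* : ∀ {a b} → 0ℚ ≤ a → 0ℚ ≤ b → 0ℚ ≤ a * b
  0≤* {a} {b} 0≤a 0≤b = ≤-trans (≤-reflexive (sym (*-zeroʳ a))) (scale-≤ 0≤a 0≤b)

  0≤+ : ∀ {a b} → 0ℚ ≤ a → 0ℚ ≤ b → 0ℚ ≤ a + b
  0≤+ = +-mono-≤

  0<⇒*-cancelˡ : ∀ {c a b} → 0ℚ < c → c * a ≡ c * b → a ≡ b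
  0<⇒*-cancelˡ {c} 0<c eq = ≤-antisym
    (*-cancelˡ-≤-pos c {{positive 0<c}} (≤-reflexive eq))
    (*-cancelˡ-≤-pos c {{positive 0<c}} (≤-reflexive (sym eq)))

  0<⇒*-cancelˡ-≤ : ∀ {c a b} → 0ℚ < c → c * a ≤ c * b → a ≤ b
  0<⇒*-cancelˡ-≤ {c} 0<c = *-cancelˡ-≤-pos c {{positive 0<c}}

  0<* : ∀ {a b} → 0ℚ < a → 0ℚ < b → 0ℚ < a * b
  0<* {a} {b} 0<a 0<b = subst (_< a * b) (*-zeroʳ a) (*-monoʳ-<-pos a {{positive 0<a}} 0<b)

  0≤½ : 0ℚ ≤ ½
  0≤½ = nonNegative⁻¹ ½

  0≤1 : 0ℚ ≤ 1ℚ
  0≤1 = nonNegative⁻¹ 1ℚ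

  -- Unary, so that `ι (suc n)` unfolds to `1ℚ + ι n` and inductions need no normalisation of
  -- fractions.
  ι : ℕ → ℚ
  ι zero    = 0ℚ
  ι (suc n) = 1ℚ + ι n

  0≤ι : ∀ n → 0ℚ ≤ ι n
  0≤ι zero    = ≤-refl
  0≤ι (suc n) = 0≤+ 0≤1 (0≤ι n)

  0<ι : ∀ n → 0ℚ < ι (suc n)
  0<ι n = +-mono-<-≤ (positive⁻¹ 1ℚ) (0≤ι n)

  ι-+ : ∀ m n → ι (m ℕ.+ n) ≡ ι m + ι n
  ι-+ zero    n = sym (+-identityˡ (ι n))
  ι-+ (suc m) n = trans (cong (1ℚ +_) (ι-+ m n)) (sym (+-assoc 1ℚ (ι m) (ι n)))

  ι-* : ∀ m n → ι (m ℕ.* n) ≡ ι m * ι n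
  ι-* zero    n = sym (*-zeroˡ (ι n))
  ι-* (suc m) n = trans (ι-+ n (m ℕ.* n)) (trans (cong (ι n +_) (ι-* m n)) (step (ι m) (ι n)))
    where
    step : ∀ a b → b + a * b ≡ (1ℚ + a) * b
    step = solve-∀ ℚ-ring

  ι-mono : ∀ {m n} → m ℕ.≤ n → ι m ≤ ι n
  ι-mono {n = n} z≤n = 0≤ι n
  ι-mono (s≤s m≤n) = +-monoʳ-≤ 1ℚ (ι-mono m≤n)

  toℚᵘ-ι : ∀ n → toℚᵘ (ι n) ℚᵘ.≃ mkℚᵘ (ℤ.+ n) 0
  toℚᵘ-ι zero    = ℚᵘ.≃-refl
  toℚᵘ-ι (suc n) = ℚᵘ.≃-trans (toℚᵘ-homo-+ 1ℚ (ι n))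
    (ℚᵘ.≃-trans (ℚᵘ.+-cong (ℚᵘ.≃-refl {toℚᵘ 1ℚ}) (toℚᵘ-ι n)) (*≡* (cong (ℤ._* (ℤ.+ 1)) (cong (ℤ._+_ (ℤ.+ 1)) (ℤ.*-identityʳ (ℤ.+ n))))))

  frac-* : ∀ a d .{{_ : ℕ.NonZero d}} → frac a d * ι d ≡ ι a
  frac-* a (suc d) = toℚᵘ-injective (ℚᵘ.≃-trans (toℚᵘ-homo-* (frac a (suc d)) (ι (suc d)))
    (ℚᵘ.≃-trans (ℚᵘ.*-cong (toℚᵘ-fromℚᵘ (mkℚᵘ (ℤ.+ a) d)) (toℚᵘ-ι (suc d)))
    (ℚᵘ.≃-trans (*≡* (trans (ℤ.*-identityʳ _) (cong (λ z → ℤ.+ a ℤ.* ℤ.+ z) (sym (ℕ.*-identityʳ (suc d)))))) (ℚᵘ.≃-sym (toℚᵘ-ι a)))))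

  infixr 8 _^_
  _^_ : ℚ → ℕ → ℚ
  p ^ zero  = 1ℚ
  p ^ suc n = p * p ^ n

  0≤^ : ∀ {p} → 0ℚ ≤ p → ∀ n → 0ℚ ≤ p ^ n
  0≤^ 0≤p zero    = 0≤1
  0≤^ 0≤p (suc n) = 0≤* 0≤p (0≤^ 0≤p n)

  ^-mono : ∀ {p q} → 0ℚ ≤ p → p ≤ q → ∀ n → p ^ n ≤ q ^ n
  ^-mono 0≤p p≤q zero    = ≤-refl
  ^-mono {p} {q} 0≤p p≤q (suc n) = ≤-trans (scale-≤ 0≤p (^-mono 0≤p p≤q n))
    (*-monoʳ-≤-nonNeg (q ^ n) {{nonNegative (0≤^ (≤-trans 0≤p p≤q) n)}} p≤q)

  ^-≤1 : ∀ {p} → 0ℚ ≤ p → p ≤ 1ℚ → ∀ n → p ^ n ≤ 1ℚ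
  ^-≤1 0≤p p≤1 zero    = ≤-refl
  ^-≤1 {p} 0≤p p≤1 (suc n) = ≤-trans (scale-≤ 0≤p (^-≤1 0≤p p≤1 n)) (≤-trans (≤-reflexive (*-identityʳ p)) p≤1)

  ^-suc-≤ : ∀ {p} → 0ℚ ≤ p → p ≤ 1ℚ → ∀ n → p ^ suc n ≤ p
  ^-suc-≤ {p} 0≤p p≤1 n = ≤-trans (scale-≤ 0≤p (^-≤1 0≤p p≤1 n)) (≤-reflexive (*-identityʳ p))

  1^ : ∀ n → 1ℚ ^ n ≡ 1ℚ
  1^ zero    = refl
  1^ (suc n) = trans (*-identityˡ _) (1^ n)

  ^-+ : ∀ p m n → p ^ (m ℕ.+ n) ≡ p ^ m * p ^ n
  ^-+ p zero    n = sym (*-identityˡ _)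
  ^-+ p (suc m) n = trans (cong (p *_) (^-+ p m n)) (sym (*-assoc p _ _))

  ^-* : ∀ p m n → p ^ (m ℕ.* n) ≡ (p ^ n) ^ m
  ^-* p zero    n = refl
  ^-* p (suc m) n = trans (^-+ p n (m ℕ.* n)) (cong (p ^ n *_) (^-* p m n))

  *-^ : ∀ p q n → (p * q) ^ n ≡ p ^ n * q ^ n
  *-^ p q zero    = refl
  *-^ p q (suc n) = trans (cong (p * q *_) (*-^ p q n)) (swap p q (p ^ n) (q ^ n))
    where
    swap : ∀ a b c d → a * b * (c * d) ≡ a * c * (b * d)
    swap = solve-∀ ℚ-ring

  ι-^ : ∀ m n → ι (m ℕ.^ n) ≡ ι m ^ n
  ι-^ m zero    = refl
  ι-^ m (suc n) = trans (ι-* m (m ℕ.^ n)) (cong (ι m *_) (ι-^ m n))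

  bernoulli-lower : ∀ {p} → 0ℚ ≤ p → p ≤ 1ℚ → ∀ n → 1ℚ - ι n * (1ℚ - p) ≤ p ^ n
  bernoulli-lower {p} 0≤p p≤1 zero = ≤-reflexive (base p)
    where
    base : ∀ p → 1ℚ - 0ℚ * (1ℚ - p) ≡ 1ℚ
    base = solve-∀ ℚ-ring
  bernoulli-lower {p} 0≤p p≤1 (suc n) = ≤-by
    (+-mono-≤ (scale-≤ 0≤p (bernoulli-lower 0≤p p≤1 n)) (0≤* (0≤ι n) (0≤* 0≤1-p 0≤1-p)))
    (step p (ι n) (p ^ n))
    where
    0≤1-p : 0ℚ ≤ 1ℚ - p
    0≤1-p = p≤q⇒0≤q-p p≤1
    step : ∀ p m x → (1ℚ - (1ℚ + m) * (1ℚ - p)) + (p * x + m * ((1ℚ - p) * (1ℚ - p)))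
                   ≡ p * x + (p * (1ℚ - m * (1ℚ - p)) + 0ℚ)
    step = solve-∀ ℚ-ring

  -- Division-free form of `p ^ n ≤ 1 / (1 + n (1 - p))`, which stands in for exponential decay.
  bernoulli-upper : ∀ {p} → 0ℚ ≤ p → p ≤ 1ℚ → ∀ n → p ^ n * (1ℚ + ι n * (1ℚ - p)) ≤ 1ℚ
  bernoulli-upper {p} 0≤p p≤1 zero = ≤-reflexive (base p)
    where
    base : ∀ p → 1ℚ * (1ℚ + 0ℚ * (1ℚ - p)) ≡ 1ℚ
    base = solve-∀ ℚ-ring
  bernoulli-upper {p} 0≤p p≤1 (suc n) = ≤-by
    (+-mono-≤ (bernoulli-upper 0≤p p≤1 n) (0≤* (0≤^ 0≤p n) (0≤* (0≤ι (suc n)) (0≤* 0≤1-p 0≤1-p))))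
    (step p (ι n) (p ^ n))
    where
    0≤1-p : 0ℚ ≤ 1ℚ - p
    0≤1-p = p≤q⇒0≤q-p p≤1
    step : ∀ p m x → p * x * (1ℚ + (1ℚ + m) * (1ℚ - p)) + (1ℚ + x * ((1ℚ + m) * ((1ℚ - p) * (1ℚ - p))))
                   ≡ 1ℚ + (x * (1ℚ + m * (1ℚ - p)) + 0ℚ)
    step = solve-∀ ℚ-ring

  -- A normalised monotone linear functional. The weights stay hidden, so coins, uniform vectors and
  -- means over satisfying assignments obey the same lemmas, and products are iterated expectations.
  record Expectation (X : Set) : Set where
    field
      𝔼           : (X → ℚ) → ℚ
      mono        : ∀ {F G} → (∀ x → F x ≤ G x) → 𝔼 F ≤ 𝔼 G
      additive    : ∀ F G → 𝔼 (λ x → F x + G x) ≡ 𝔼 F + 𝔼 G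
      homogeneous : ∀ c F → 𝔼 (λ x → c * F x) ≡ c * 𝔼 F
      normalised  : 𝔼 (λ _ → 1ℚ) ≡ 1ℚ

    𝔼-cong : ∀ {F G} → (∀ x → F x ≡ G x) → 𝔼 F ≡ 𝔼 G
    𝔼-cong eq = ≤-antisym (mono (λ x → ≤-reflexive (eq x))) (mono (λ x → ≤-reflexive (sym (eq x))))

    𝔼-const : ∀ c → 𝔼 (λ _ → c) ≡ c
    𝔼-const c = trans (𝔼-cong (λ _ → sym (*-identityʳ c)))
      (trans (homogeneous c (λ _ → 1ℚ)) (trans (cong (c *_) normalised) (*-identityʳ c)))

    𝔼-*ʳ : ∀ F c → 𝔼 (λ x → F x * c) ≡ 𝔼 F * c
    𝔼-*ʳ F c = trans (𝔼-cong (λ x → *-comm (F x) c)) (trans (homogeneous c F) (*-comm c (𝔼 F)))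

    𝔼-≤ : ∀ {F c} → (∀ x → F x ≤ c) → 𝔼 F ≤ c
    𝔼-≤ {c = c} le = ≤-trans (mono le) (≤-reflexive (𝔼-const c))

    𝔼-≥ : ∀ {F c} → (∀ x → c ≤ F x) → c ≤ 𝔼 F
    𝔼-≥ {c = c} le = ≤-trans (≤-reflexive (sym (𝔼-const c))) (mono le)

    𝔼-≤+ : ∀ {F G H} → (∀ x → F x ≤ G x + H x) → 𝔼 F ≤ 𝔼 G + 𝔼 H
    𝔼-≤+ {G = G} {H} le = ≤-trans (mono le) (≤-reflexive (additive G H))

    𝔼-complement : ∀ F → 𝔼 (λ x → 1ℚ - F x) ≡ 1ℚ - 𝔼 F
    𝔼-complement F = trans (𝔼-cong (λ x → cong (1ℚ +_) (negate (F x))))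
      (trans (additive (λ _ → 1ℚ) (λ x → (- 1ℚ) * F x))
        (cong₂ _+_ normalised (trans (homogeneous (- 1ℚ) F) (sym (negate (𝔼 F))))))
      where
      negate : ∀ x → - x ≡ (- 1ℚ) * x
      negate = solve-∀ ℚ-ring

  open Expectation

  coinᴱ : Expectation Bool
  coinᴱ = record
    { 𝔼           = λ F → ½ * (F false + F true)
    ; mono        = λ le → scale-≤ 0≤½ (+-mono-≤ (le false) (le true))
    ; additive    = λ F G → add (F false) (G false) (F true) (G true)
    ; homogeneous = λ c F → hom c (F false) (F true)
    ; normalised  = refl
    }
    where
    add : ∀ a b c d → ½ * ((a + b) + (c + d)) ≡ ½ * (a + c) + ½ * (b + d)
    add = solve-∀ ℚ-ring
    hom : ∀ c a b → ½ * (c * a + c * b) ≡ c * (½ * (a + b))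
    hom = solve-∀ ℚ-ring

  _⊗_via_ : ∀ {X Y Z : Set} → Expectation X → Expectation Y → (X → Y → Z) → Expectation Z
  ex ⊗ ey via h = record
    { 𝔼           = λ F → 𝔼 ex (λ x → 𝔼 ey (λ y → F (h x y)))
    ; mono        = λ le → mono ex (λ x → mono ey (λ y → le (h x y)))
    ; additive    = λ F G → trans (𝔼-cong ex (λ x → additive ey _ _)) (additive ex _ _)
    ; homogeneous = λ c F → trans (𝔼-cong ex (λ x → homogeneous ey c _)) (homogeneous ex c _)
    ; normalised  = trans (𝔼-cong ex (λ x → normalised ey)) (normalised ex)
    }

  pointᴱ : ∀ {X : Set} → X → Expectation X
  pointᴱ x = record
    { 𝔼           = λ F → F x
    ; mono        = λ le → le x
    ; additive    = λ F G → refl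
    ; homogeneous = λ c F → refl
    ; normalised  = refl
    }

  vecᴱ : ∀ {X : Set} → Expectation X → ∀ n → Expectation (Vec X n)
  vecᴱ ex zero    = pointᴱ []
  vecᴱ ex (suc n) = ex ⊗ vecᴱ ex n via _∷_

  cube : ∀ n → Expectation (Cube n)
  cube = vecᴱ coinᴱ

  -- Fubini: the cube expectation is built from averages of two values, so linearity of `ex` moves
  -- through it one coordinate at a time.
  𝔼-swap : ∀ {X} (ex : Expectation X) n (F : X → Cube n → ℚ) →
    𝔼 ex (λ x → 𝔼 (cube n) (F x)) ≡ 𝔼 (cube n) (λ z → 𝔼 ex (λ x → F x z))
  𝔼-swap ex zero    F = refl
  𝔼-swap ex (suc n) F = trans (homogeneous ex ½ _) (cong (½ *_) (trans (additive ex _ _)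
    (cong₂ _+_ (𝔼-swap ex n (λ x z → F x (false ∷ z))) (𝔼-swap ex n (λ x z → F x (true ∷ z))))))

  ∃-below-𝔼 : ∀ n (F : Cube n → ℚ) {c} → 𝔼 (cube n) F < c → ∃[ z ] F z < c
  ∃-below-𝔼 zero    F lt = [] , lt
  ∃-below-𝔼 (suc n) F {c} lt with 𝔼 (cube n) (λ z → F (false ∷ z)) <? c
  ... | yes lt₀ = let z , p = ∃-below-𝔼 n _ lt₀ in false ∷ z , p
  ... | no ≮c with 𝔼 (cube n) (λ z → F (true ∷ z)) <? c
  ...   | yes lt₁ = let z , p = ∃-below-𝔼 n _ lt₁ in true ∷ z , p
  ...   | no ≮c′ = ⊥-elim (<-irrefl refl (<-≤-trans lt (≤-by (scale-≤ 0≤½ (+-mono-≤ (≮⇒≥ ≮c) (≮⇒≥ ≮c′))) (half c _))))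
    where
    half : ∀ c x → c + x ≡ x + ½ * (c + c)
    half = solve-∀ ℚ-ring

  𝔼-positive : ∀ n (F : Cube n → ℚ) → (∀ z → 0ℚ ≤ F z) → ∀ z → 0ℚ < F z → 0ℚ < 𝔼 (cube n) F
  𝔼-positive zero    F 0≤F [] 0<F = 0<F
  𝔼-positive (suc n) F 0≤F (false ∷ z) 0<F = 0<* (positive⁻¹ ½)
    (+-mono-<-≤ (𝔼-positive n _ (λ z → 0≤F (false ∷ z)) z 0<F) (𝔼-≥ (cube n) (λ z → 0≤F (true ∷ z))))
  𝔼-positive (suc n) F 0≤F (true ∷ z) 0<F = 0<* (positive⁻¹ ½)
    (+-mono-≤-< (𝔼-≥ (cube n) (λ z → 0≤F (false ∷ z))) (𝔼-positive n _ (λ z → 0≤F (true ∷ z)) z 0<F))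

  -- The cube as a Boolean algebra, and means over satisfying assignments

  infixl 6 _⊕_
  _⊕_ : ∀ {n} → Cube n → Cube n → Cube n
  _⊕_ = zipWith _xor_

  lookup-ext : ∀ {n} {x y : Cube n} → (∀ i → lookup x i ≡ lookup y i) → x ≡ y
  lookup-ext {x = []}    {[]}    eq = refl
  lookup-ext {x = b ∷ x} {c ∷ y} eq = cong₂ _∷_ (eq zero) (lookup-ext (eq ∘ suc))

  infixl 6 _:⊕_
  infixl 7 _:∩_
  data BoolExpr (k : ℕ) : Set where
    var       : Fin k → BoolExpr k
    _:⊕_ _:∩_ : BoolExpr k → BoolExpr k → BoolExpr k
    :∁        : BoolExpr k → BoolExpr k
    :∅ :⊤     : BoolExpr k

  evalᵇ : ∀ {k} → BoolExpr k → Vec Bool k → Bool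
  evalᵇ (var i)    v = lookup v i
  evalᵇ (e :⊕ e′)  v = evalᵇ e v xor evalᵇ e′ v
  evalᵇ (e :∩ e′)  v = evalᵇ e v ∧ᵇ evalᵇ e′ v
  evalᵇ (:∁ e)     v = not (evalᵇ e v)
  evalᵇ :∅         v = false
  evalᵇ :⊤         v = true

  evalᶜ : ∀ {n k} → BoolExpr k → Vec (Cube n) k → Cube n
  evalᶜ (var i)    ρ = lookup ρ i
  evalᶜ (e :⊕ e′)  ρ = evalᶜ e ρ ⊕ evalᶜ e′ ρ
  evalᶜ (e :∩ e′)  ρ = evalᶜ e ρ ∩ evalᶜ e′ ρ
  evalᶜ (:∁ e)     ρ = ∁ (evalᶜ e ρ)
  evalᶜ :∅         ρ = ∅
  evalᶜ :⊤         ρ = ⊤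

  lookup-evalᶜ : ∀ {n k} (e : BoolExpr k) (ρ : Vec (Cube n) k) i →
    lookup (evalᶜ e ρ) i ≡ evalᵇ e (Vec.map (λ x → lookup x i) ρ)
  lookup-evalᶜ (var j)   ρ i = sym (Vec.lookup-map j (λ x → lookup x i) ρ)
  lookup-evalᶜ (e :⊕ e′) ρ i = trans (Vec.lookup-zipWith _xor_ i (evalᶜ e ρ) (evalᶜ e′ ρ))
    (cong₂ _xor_ (lookup-evalᶜ e ρ i) (lookup-evalᶜ e′ ρ i))
  lookup-evalᶜ (e :∩ e′) ρ i = trans (Vec.lookup-zipWith _∧ᵇ_ i (evalᶜ e ρ) (evalᶜ e′ ρ))
    (cong₂ _∧ᵇ_ (lookup-evalᶜ e ρ i) (lookup-evalᶜ e′ ρ i))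
  lookup-evalᶜ (:∁ e)    ρ i = trans (Vec.lookup-map i not (evalᶜ e ρ)) (cong not (lookup-evalᶜ e ρ i))
  lookup-evalᶜ :∅        ρ i = Vec.lookup-replicate i false
  lookup-evalᶜ :⊤        ρ i = Vec.lookup-replicate i true

  everywhere : ∀ k → (Vec Bool k → Bool) → Bool
  everywhere zero    p = p []
  everywhere (suc k) p = everywhere k (p ∘ (false ∷_)) ∧ᵇ everywhere k (p ∘ (true ∷_))

  everywhere-sound : ∀ k p → T (everywhere k p) → ∀ v → T (p v)
  everywhere-sound zero    p t [] = t
  everywhere-sound (suc k) p t (b ∷ v) with everywhere k (p ∘ (false ∷_)) in eq
  everywhere-sound (suc k) p t (false ∷ v) | true = everywhere-sound k (p ∘ (false ∷_)) (subst T (sym eq) tt) v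
  everywhere-sound (suc k) p t (true ∷ v)  | true = everywhere-sound k (p ∘ (true ∷_)) t v

  xnor-sound : ∀ b c → T (not (b xor c)) → b ≡ c
  xnor-sound false false _ = refl
  xnor-sound true  true  _ = refl

  -- Identities between sets of variables hold coordinatewise, hence by truth table. For concrete
  -- expressions the implicit argument computes to the unit type and is filled by eta.
  cube-id : ∀ {n k} (e e′ : BoolExpr k) {_ : T (everywhere k (λ v → not (evalᵇ e v xor evalᵇ e′ v)))} →
    (ρ : Vec (Cube n) k) → evalᶜ e ρ ≡ evalᶜ e′ ρ
  cube-id {k = k} e e′ {t} ρ = lookup-ext λ i → trans (lookup-evalᶜ e ρ i)
    (trans (xnor-sound _ _ (everywhere-sound k _ t _)) (sym (lookup-evalᶜ e′ ρ i)))

  v₀ : ∀ {k} → BoolExpr (1 ℕ.+ k)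
  v₀ = var zero
  v₁ : ∀ {k} → BoolExpr (2 ℕ.+ k)
  v₁ = var (suc zero)
  v₂ : ∀ {k} → BoolExpr (3 ℕ.+ k)
  v₂ = var (suc (suc zero))
  v₃ : ∀ {k} → BoolExpr (4 ℕ.+ k)
  v₃ = var (suc (suc (suc zero)))

  v₄ : ∀ {k} → BoolExpr (5 ℕ.+ k)
  v₄ = var (suc (suc (suc (suc zero))))

  lookup-⊕ : ∀ {n} (x y : Cube n) i → lookup (x ⊕ y) i ≡ lookup x i xor lookup y i
  lookup-⊕ x y i = Vec.lookup-zipWith _xor_ i x y

  lookup-∩ : ∀ {n} (x y : Cube n) i → lookup (x ∩ y) i ≡ lookup x i ∧ᵇ lookup y i
  lookup-∩ x y i = Vec.lookup-zipWith _∧ᵇ_ i x y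

  lookup-∁ : ∀ {n} (x : Cube n) i → lookup (∁ x) i ≡ not (lookup x i)
  lookup-∁ x i = Vec.lookup-map i not x

  𝔼-shift : ∀ n (a : Cube n) (F : Cube n → ℚ) → 𝔼 (cube n) (λ z → F (z ⊕ a)) ≡ 𝔼 (cube n) F
  𝔼-shift zero    []          F = refl
  𝔼-shift (suc n) (false ∷ a) F = cong₂ (λ p q → ½ * (p + q))
    (𝔼-shift n a (F ∘ (false ∷_))) (𝔼-shift n a (F ∘ (true ∷_)))
  𝔼-shift (suc n) (true ∷ a)  F = trans (cong (½ *_) (+-comm (𝔼 (cube n) (λ z → F (true ∷ (z ⊕ a)))) _))
    (cong₂ (λ p q → ½ * (p + q)) (𝔼-shift n a (F ∘ (false ∷_))) (𝔼-shift n a (F ∘ (true ∷_))))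

  𝟙 : Bool → ℚ
  𝟙 b = if b then 1ℚ else 0ℚ

  0≤𝟙 : ∀ b → 0ℚ ≤ 𝟙 b
  0≤𝟙 false = ≤-refl
  0≤𝟙 true  = 0≤1

  𝟙≤1 : ∀ b → 𝟙 b ≤ 1ℚ
  𝟙≤1 false = 0≤1
  𝟙≤1 true  = ≤-refl

  sum-over : ∀ {A : Set} → (A → ℚ) → List A → ℚ
  sum-over F xs = sumℚ (map F xs)

  sum-over-cubes : ∀ n (F : Cube n → ℚ) → sum-over F (allPoints n) ≡ ι (2 ℕ.^ n) * 𝔼 (cube n) F
  sum-over-cubes zero    F = step (F [])
    where
    step : ∀ x → x + 0ℚ ≡ (1ℚ + 0ℚ) * x
    step = solve-∀ ℚ-ring
  sum-over-cubes (suc n) F = trans (pairs (allPoints n)) (trans (sum-over-cubes n _)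
    (trans (cong (ι (2 ℕ.^ n) *_) (additive (cube n) _ _))
    (trans (step (ι (2 ℕ.^ n)) _) (cong (_* 𝔼 (cube (suc n)) F) (sym (ι-* 2 (2 ℕ.^ n)))))))
    where
    pairs : ∀ xs → sum-over F (concatMap (λ x → (false ∷ x) ∷ (true ∷ x) ∷ []) xs)
                 ≡ sum-over (λ x → F (false ∷ x) + F (true ∷ x)) xs
    pairs []       = refl
    pairs (x ∷ xs) = trans (cong (λ t → F (false ∷ x) + (F (true ∷ x) + t)) (pairs xs))
      (sym (+-assoc (F (false ∷ x)) (F (true ∷ x)) _))
    step : ∀ c s → c * s ≡ (1ℚ + (1ℚ + 0ℚ)) * c * (½ * s)
    step = solve-∀ ℚ-ring

  sum-over-filter : ∀ {A : Set} (p : A → Bool) (F : A → ℚ) xs →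
    sum-over F (filterᵇ p xs) ≡ sum-over (λ x → 𝟙 (p x) * F x) xs
  sum-over-filter p F []       = refl
  sum-over-filter p F (x ∷ xs) with p x
  ... | true  = cong₂ _+_ (sym (*-identityˡ (F x))) (sum-over-filter p F xs)
  ... | false = trans (sum-over-filter p F xs)
    (sym (trans (cong (_+ _) (*-zeroˡ (F x))) (+-identityˡ _)))

  ι-length : ∀ {A : Set} (xs : List A) → ι (length xs) ≡ sum-over (λ _ → 1ℚ) xs
  ι-length []       = refl
  ι-length (x ∷ xs) = cong (1ℚ +_) (ι-length xs)

  ι-length-filter : ∀ {n} (p : Cube n → Bool) →
    ι (length (filterᵇ p (allPoints n))) ≡ ι (2 ℕ.^ n) * 𝔼 (cube n) (𝟙 ∘ p)
  ι-length-filter {n} p = trans (ι-length (filterᵇ p (allPoints n)))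
    (trans (sum-over-filter p (λ _ → 1ℚ) (allPoints n))
    (trans (sum-over-cubes n _) (cong (ι (2 ℕ.^ n) *_) (𝔼-cong (cube n) λ x → *-identityʳ (𝟙 (p x))))))

  ι-*-avg : ∀ ps → ι (length ps) * avg ps ≡ sumℚ ps
  ι-*-avg []       = refl
  ι-*-avg (p ∷ ps) = trans (step (ι (length (p ∷ ps))) (frac 1 (length (p ∷ ps))) (sumℚ (p ∷ ps)))
    (trans (cong (_* sumℚ (p ∷ ps)) (frac-* 1 (length (p ∷ ps)))) (*-identityˡ _))
    where
    step : ∀ a b c → a * (b * c) ≡ b * a * c
    step = solve-∀ ℚ-ring

  0<2^ : ∀ n → 0ℚ < ι (2 ℕ.^ n)
  0<2^ zero    = positive⁻¹ 1ℚ
  0<2^ (suc n) = subst (0ℚ <_) (sym (ι-* 2 (2 ℕ.^ n))) (0<* (positive⁻¹ (ι 2)) (0<2^ n))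

  density : ∀ {n} → BoolFun n → ℚ
  density {n} f = 𝔼 (cube n) (𝟙 ∘ f)

  0<density : ∀ {n} {f : BoolFun n} → Nonempty f → 0ℚ < density f
  0<density {n} {f} (x , fx) = 𝔼-positive n (𝟙 ∘ f) (λ z → 0≤𝟙 (f z)) x
    (subst (λ b → 0ℚ < 𝟙 b) (sym fx) (positive⁻¹ 1ℚ))

  mean : ∀ {n} → BoolFun n → (Cube n → ℚ) → ℚ
  mean f F = avg (map F (ones f))

  -- Conditional expectation given `f` = 1, multiplied by the probability of the condition to avoid
  -- a division. The laws of `mean` are proved on the right-hand side and transferred by cancelling
  -- `density f`.
  density-*-mean : ∀ {n} (f : BoolFun n) (F : Cube n → ℚ) →
    density f * mean f F ≡ 𝔼 (cube n) (λ x → 𝟙 (f x) * F x)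
  density-*-mean {n} f F = 0<⇒*-cancelˡ (0<2^ n) (trans (sym (*-assoc (ι (2 ℕ.^ n)) (density f) (mean f F)))
    (trans (cong (_* mean f F) (sym (ι-length-filter f)))
    (trans (cong (λ l → ι l * mean f F) (sym (length-map F (ones f))))
    (trans (ι-*-avg (map F (ones f))) (trans (sum-over-filter f F (allPoints n)) (sum-over-cubes n _))))))

  sampleᴱ : ∀ {n} {f : BoolFun n} → Nonempty f → Expectation (Cube n)
  sampleᴱ {n} {f} ne = record
    { 𝔼           = mean f
    ; mono        = λ {F} {G} le → 0<⇒*-cancelˡ-≤ (0<density ne)
        (subst₂ _≤_ (sym (density-*-mean f F)) (sym (density-*-mean f G))
          (mono (cube n) λ x → scale-≤ (0≤𝟙 (f x)) (le x)))
    ; additive    = λ F G → cancel (trans (density-*-mean f _)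
        (trans (𝔼-cong (cube n) λ x → *-distribˡ-+ (𝟙 (f x)) (F x) (G x))
        (trans (additive (cube n) _ _)
        (trans (cong₂ _+_ (sym (density-*-mean f F)) (sym (density-*-mean f G)))
          (sym (*-distribˡ-+ (density f) _ _))))))
    ; homogeneous = λ c F → cancel (trans (density-*-mean f _)
        (trans (𝔼-cong (cube n) λ x → move (𝟙 (f x)) c (F x))
        (trans (homogeneous (cube n) c _)
        (trans (cong (c *_) (sym (density-*-mean f F))) (move c (density f) (mean f F))))))
    ; normalised  = cancel (trans (density-*-mean f _) (𝔼-*ʳ (cube n) (𝟙 ∘ f) 1ℚ))
    }
    where
    cancel : ∀ {a b} → density f * a ≡ density f * b → a ≡ b
    cancel = 0<⇒*-cancelˡ (0<density ne)
    move : ∀ a b c → a * (b * c) ≡ b * (a * c)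
    move = solve-∀ ℚ-ring

  relDist-*-density : ∀ {n} (f g : BoolFun n) → Nonempty f →
    relDist f g * density f ≡ 𝔼 (cube n) (λ x → 𝟙 (f x xor g x))
  relDist-*-density {n} f g ne = 0<⇒*-cancelˡ (0<2^ n)
    (trans (move (ι (2 ℕ.^ n)) (relDist f g) (density f))
    (trans (cong (relDist f g *_) (sym (ι-length-filter f)))
    (trans (frac-* _ (weight f) {{weight≢0}}) (ι-length-filter (λ x → f x xor g x)))))
    where
    move : ∀ a b c → a * (b * c) ≡ b * (a * c)
    move = solve-∀ ℚ-ring
    0<ιw : 0ℚ < ι (weight f)
    0<ιw = subst (0ℚ <_) (sym (ι-length-filter f)) (0<* (0<2^ n) (0<density ne))
    weight≢0 : ℕ.NonZero (weight f)
    weight≢0 with weight f | 0<ιw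
    ... | zero  | 0<0 = ⊥-elim (<-irrefl refl 0<0)
    ... | suc _ | _   = _

  -- The tester

  -- The cell is a set of variables meant to contain exactly one relevant variable τ, and the base a
  -- satisfying assignment; then a ↦ f (at B a) is the literal 1 - a_τ.
  record Block (n : ℕ) : Set where
    constructor block
    field
      base cell : Cube n

  open Block

  at : ∀ {n} → Block n → Cube n → Cube n
  at (block v X) a = v ⊕ (a ∩ X)

  free : ∀ {n} → List (Block n) → Cube n
  free []       = ⊤
  free (B ∷ Bs) = free Bs ∩ ∁ (cell B)

  -- New blocks are put in front, so `free Bs` refers to the older ones: each cell avoids all
  -- earlier cells.
  Separated : ∀ {n} → List (Block n) → Set
  Separated []       = Data.Unit.⊤
  Separated (B ∷ Bs) = cell B ∩ free Bs ≡ cell B × Separated Bs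

  Valid : ∀ {n} → ℕ → List (Block n) → Set
  Valid k Bs = length Bs ℕ.≤ k × Separated Bs

  separated? : ∀ {n} (Bs : List (Block n)) → Dec (Separated Bs)
  separated? []       = yes tt
  separated? (B ∷ Bs) = Vec.≡-dec 𝔹._≟_ (cell B ∩ free Bs) (cell B) ×-dec separated? Bs

  valid? : ∀ {n} k (Bs : List (Block n)) → Dec (Valid k Bs)
  valid? k Bs = (length Bs ℕ.≤? k) ×-dec separated? Bs

  guard : ∀ {n} → Bool → Alg n → Alg n
  guard b t = if b then t else halt false

  randomCube : ∀ {n} m → (Cube m → Alg n) → Alg n
  randomCube zero    t = t []
  randomCube (suc m) t = coin λ b → randomCube m λ z → t (b ∷ z)

  randomCubes : ∀ {n} m b → (Vec (Cube m) b → Alg n) → Alg n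
  randomCubes m zero    t = t []
  randomCubes m (suc b) t = randomCube m λ M → randomCubes m b λ Ms → t (M ∷ Ms)

  -- A constant section would always pass the comparison of `p` with `q`; the antipodal query is
  -- what it fails. A literal whose variable lies outside `O` passes both comparisons surely.
  check : ∀ {n} → Block n → Cube n → Alg n → Alg n
  check {n} B O t = randomCube n λ a → randomCube n λ r →
    query (at B a) λ p → query (at B (a ⊕ (r ∩ O))) λ q → query (at B (∁ a)) λ q′ →
    guard (not (p xor q) ∧ᵇ (p xor q′)) t

  checks : ∀ {n} → ℕ → Block n → Cube n → Alg n → Alg n
  checks zero    B O t = t
  checks (suc s) B O t = check B O (checks s B O t)

  -- The one of `Z` and `∁ Z` claimed to miss the relevant variable, `d` being the answer that `Z`
  -- contains it.
  side : ∀ {n} → Bool → Cube n → Cube n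
  side d Z = if d then ∁ Z else Z

  toggle : ∀ {n} → Bool → Cube n → Cube n → Cube n
  toggle d X W = if d then W ⊕ X else W

  -- W accumulates the set of variables to be flipped: Z, complemented inside every block where it
  -- contains the relevant variable.
  probe : ∀ {n} → ℕ → List (Block n) → Cube n → Cube n → (Cube n → Alg n) → Alg n
  probe s []       Z W t = t W
  probe s (B ∷ Bs) Z W t = query (at B ∅) λ p → query (at B Z) λ q →
    checks s B (side (p xor q) Z) (probe s Bs Z (toggle (p xor q) (cell B) W) t)

  verifyRounds : ∀ {n} → ℕ → ℕ → List (Block n) → Alg n
  verifyRounds     s zero    Bs = halt true
  verifyRounds {n} s (suc m) Bs = randomCube n λ Z → probe s Bs Z Z λ W →
    sample λ x → query (x ⊕ W) λ b → guard b (verifyRounds s m Bs)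

  -- Validity is decided without oracle calls, so soundness and the bound on calls may assume at
  -- most `k` blocks with disjoint cells, whatever the exploration produced.
  verify : ∀ {n} → ℕ → ℕ → ℕ → List (Block n) → Alg n
  verify k s m Bs = if does (valid? k Bs) then verifyRounds s m Bs else halt false

  -- Invariant: f x = 1, f (x ⊕ w) = 0 and w ⊆ X.
  search : ∀ {n b} → Vec (Cube n) b → Cube n → Cube n → Cube n → (Block n → Alg n) → Alg n
  search []       x w X t = t (block x X)
  search (M ∷ Ms) x w X t = query (x ⊕ (w ∩ M)) λ p →
    if p then search Ms (x ⊕ (w ∩ M)) (w ∩ ∁ M) (X ∩ ∁ M) t
         else search Ms x (w ∩ M) (X ∩ M) t

  explore : ∀ {n b} → Vec (Cube n) b → ℕ → List (Block n) → (List (Block n) → Alg n) → Alg n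
  explore     Ms zero    Bs t = t Bs
  explore {n} Ms (suc r) Bs t = sample λ x → randomCube n λ w →
    query (x ⊕ (w ∩ free Bs)) λ p →
    if p then explore Ms r Bs t
         else search Ms x (w ∩ free Bs) (free Bs) λ B → explore Ms r (B ∷ Bs) t

  tester : ∀ n (k b r s m : ℕ) → Alg n
  tester n k b r s m = randomCubes n b λ Ms → explore Ms r [] (verify k s m)

  -- Acceptance probabilities of the phases of the tester

  accProb-randomCube : ∀ {n} (f : BoolFun n) m t →
    accProb f (randomCube m t) ≡ 𝔼 (cube m) (λ z → accProb f (t z))
  accProb-randomCube f zero    t = refl
  accProb-randomCube f (suc m) t = cong₂ (λ p q → ½ * (p + q))
    (accProb-randomCube f m (t ∘ (false ∷_))) (accProb-randomCube f m (t ∘ (true ∷_)))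

  accProb-randomCubes : ∀ {n} (f : BoolFun n) m b t →
    accProb f (randomCubes m b t) ≡ 𝔼 (vecᴱ (cube m) b) (λ Ms → accProb f (t Ms))
  accProb-randomCubes f m zero    t = refl
  accProb-randomCubes f m (suc b) t = trans (accProb-randomCube f m _)
    (𝔼-cong (cube m) λ M → accProb-randomCubes f m b (t ∘ (M ∷_)))

  accProb-guard : ∀ {n} (f : BoolFun n) b t → accProb f (guard b t) ≡ 𝟙 b * accProb f t
  accProb-guard f false t = sym (*-zeroˡ (accProb f t))
  accProb-guard f true  t = sym (*-identityˡ (accProb f t))

  accProb-≥0 : ∀ {n} {f : BoolFun n} → Nonempty f → ∀ A → 0ℚ ≤ accProb f A
  accProb-≥0 ne (halt b)    = 0≤𝟙 b
  accProb-≥0 {f = f} ne (query x t) = accProb-≥0 ne (t (f x))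
  accProb-≥0 ne (sample t)  = 𝔼-≥ (sampleᴱ ne) λ x → accProb-≥0 ne (t x)
  accProb-≥0 ne (coin t)    = 𝔼-≥ coinᴱ λ b → accProb-≥0 ne (t b)

  accProb-≤1 : ∀ {n} {f : BoolFun n} → Nonempty f → ∀ A → accProb f A ≤ 1ℚ
  accProb-≤1 ne (halt b)    = 𝟙≤1 b
  accProb-≤1 {f = f} ne (query x t) = accProb-≤1 ne (t (f x))
  accProb-≤1 ne (sample t)  = 𝔼-≤ (sampleᴱ ne) λ x → accProb-≤1 ne (t x)
  accProb-≤1 ne (coin t)    = 𝔼-≤ coinᴱ λ b → accProb-≤1 ne (t b)

  section : ∀ {n} → BoolFun n → Block n → BoolFun n
  section f B a = f (at B a)

  steady : ∀ {n} → BoolFun n → Cube n → Cube n → Cube n → Bool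
  steady h O a r = not (h a xor h (a ⊕ (r ∩ O))) ∧ᵇ (h a xor h (∁ a))

  passRate : ∀ {n} → BoolFun n → Cube n → ℚ
  passRate {n} h O = 𝔼 (cube n) λ a → 𝔼 (cube n) λ r → 𝟙 (steady h O a r)

  0≤passRate : ∀ {n} (h : BoolFun n) O → 0ℚ ≤ passRate h O
  0≤passRate {n} h O = 𝔼-≥ (cube n) λ a → 𝔼-≥ (cube n) λ r → 0≤𝟙 (steady h O a r)

  passRate≤1 : ∀ {n} (h : BoolFun n) O → passRate h O ≤ 1ℚ
  passRate≤1 {n} h O = 𝔼-≤ (cube n) λ a → 𝔼-≤ (cube n) λ r → 𝟙≤1 (steady h O a r)

  accProb-checks : ∀ {n} (f : BoolFun n) s B O t →
    accProb f (checks s B O t) ≡ passRate (section f B) O ^ s * accProb f t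
  accProb-checks         f zero    B O t = sym (*-identityˡ (accProb f t))
  accProb-checks {n = n} f (suc s) B O t = trans (accProb-randomCube f n _)
    (trans (𝔼-cong (cube n) λ a → trans (accProb-randomCube f n _)
      (trans (𝔼-cong (cube n) λ r → accProb-guard f (steady (section f B) O a r) (checks s B O t))
        (𝔼-*ʳ (cube n) _ rest)))
    (trans (𝔼-*ʳ (cube n) _ rest)
    (trans (cong (κ *_) (accProb-checks f s B O t)) (sym (*-assoc κ (κ ^ s) (accProb f t))))))
    where
    κ    = passRate (section f B) O
    rest = accProb f (checks s B O t)

  -- The coordinate on which h is expected to depend lies in Z exactly when h tells Z from ∅.
  hit : ∀ {n} → BoolFun n → Cube n → Bool
  hit h Z = h ∅ xor h Z

  blockRate : ∀ {n} → BoolFun n → ℕ → Cube n → ℚ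
  blockRate h s Z = passRate h (side (hit h Z) Z) ^ s

  0≤blockRate : ∀ {n} (h : BoolFun n) s Z → 0ℚ ≤ blockRate h s Z
  0≤blockRate h s Z = 0≤^ (0≤passRate h (side (hit h Z) Z)) s

  blockRate≤1 : ∀ {n} (h : BoolFun n) s Z → blockRate h s Z ≤ 1ℚ
  blockRate≤1 h s Z = ^-≤1 (0≤passRate h (side (hit h Z) Z)) (passRate≤1 h (side (hit h Z) Z)) s

  moved : ∀ {n} → BoolFun n → Block n → Cube n → Cube n → Cube n
  moved f B Z W = toggle (hit (section f B) Z) (cell B) W

  -- Given `Z`, the answers on the sides are determined by `f`; only the checks are random, and
  -- their success probabilities multiply. `F` receives the set finally flipped.
  probed : ∀ {n} → BoolFun n → ℕ → List (Block n) → Cube n → Cube n → (Cube n → ℚ) → ℚ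
  probed f s []       Z W F = F W
  probed f s (B ∷ Bs) Z W F = blockRate (section f B) s Z * probed f s Bs Z (moved f B Z W) F

  probed-*ʳ : ∀ {n} (f : BoolFun n) s Bs Z W F c →
    probed f s Bs Z W (λ W → F W * c) ≡ probed f s Bs Z W F * c
  probed-*ʳ f s []       Z W F c = refl
  probed-*ʳ f s (B ∷ Bs) Z W F c = trans (cong (blockRate (section f B) s Z *_) (probed-*ʳ f s Bs Z (moved f B Z W) F c))
    (sym (*-assoc (blockRate (section f B) s Z) (probed f s Bs Z (moved f B Z W) F) c))

  probed-cong : ∀ {n} (f : BoolFun n) s Bs Z W {F G} → (∀ W → F W ≡ G W) →
    probed f s Bs Z W F ≡ probed f s Bs Z W G
  probed-cong f s []       Z W eq = eq W
  probed-cong f s (B ∷ Bs) Z W eq = cong (blockRate (section f B) s Z *_) (probed-cong f s Bs Z (moved f B Z W) eq)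

  accProb-probe : ∀ {n} (f : BoolFun n) s Bs Z W t →
    accProb f (probe s Bs Z W t) ≡ probed f s Bs Z W (λ W → accProb f (t W))
  accProb-probe f s []       Z W t = refl
  accProb-probe f s (B ∷ Bs) Z W t = trans (accProb-checks f s B (side d Z) _)
    (cong (passRate (section f B) (side d Z) ^ s *_) (accProb-probe f s Bs Z (toggle d (cell B) W) t))
    where
    d = hit (section f B) Z

  stay : ∀ {n} → BoolFun n → Cube n → ℚ
  stay f W = mean f λ x → 𝟙 (f (x ⊕ W))

  roundRate : ∀ {n} → BoolFun n → ℕ → List (Block n) → ℚ
  roundRate {n} f s Bs = 𝔼 (cube n) λ Z → probed f s Bs Z Z (stay f)

  accProb-verifyRounds : ∀ {n} {f : BoolFun n} → Nonempty f → ∀ s m Bs →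
    accProb f (verifyRounds s m Bs) ≡ roundRate f s Bs ^ m
  accProb-verifyRounds ne s zero Bs = refl
  accProb-verifyRounds {n} {f} ne s (suc m) Bs = trans (accProb-randomCube f n _)
    (trans (𝔼-cong (cube n) λ Z → trans (accProb-probe f s Bs Z Z _)
      (trans (probed-cong f s Bs Z Z λ W → trans
        (𝔼-cong (sampleᴱ ne) λ x → accProb-guard f (f (x ⊕ W)) (verifyRounds s m Bs))
        (𝔼-*ʳ (sampleᴱ ne) _ _))
      (probed-*ʳ f s Bs Z Z (stay f) _)))
    (trans (𝔼-*ʳ (cube n) _ _) (cong (roundRate f s Bs *_) (accProb-verifyRounds ne s m Bs))))

  0≤stay : ∀ {n} {f : BoolFun n} → Nonempty f → ∀ W → 0ℚ ≤ stay f W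
  0≤stay {f = f} ne W = 𝔼-≥ (sampleᴱ ne) λ x → 0≤𝟙 (f (x ⊕ W))

  stay≤1 : ∀ {n} {f : BoolFun n} → Nonempty f → ∀ W → stay f W ≤ 1ℚ
  stay≤1 {f = f} ne W = 𝔼-≤ (sampleᴱ ne) λ x → 𝟙≤1 (f (x ⊕ W))

  *-≤1 : ∀ {a b} → 0ℚ ≤ a → a ≤ 1ℚ → b ≤ 1ℚ → a * b ≤ 1ℚ
  *-≤1 0≤a a≤1 b≤1 = ≤-trans (scale-≤ 0≤a b≤1) (≤-trans (≤-reflexive (*-identityʳ _)) a≤1)

  0≤probed : ∀ {n} (f : BoolFun n) s Bs Z W {F} → (∀ W → 0ℚ ≤ F W) → 0ℚ ≤ probed f s Bs Z W F
  0≤probed f s []       Z W 0≤F = 0≤F W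
  0≤probed f s (B ∷ Bs) Z W 0≤F = 0≤* (0≤blockRate (section f B) s Z) (0≤probed f s Bs Z (moved f B Z W) 0≤F)

  probed≤1 : ∀ {n} (f : BoolFun n) s Bs Z W {F} → (∀ W → F W ≤ 1ℚ) → probed f s Bs Z W F ≤ 1ℚ
  probed≤1 f s []       Z W F≤1 = F≤1 W
  probed≤1 f s (B ∷ Bs) Z W F≤1 = *-≤1 (0≤blockRate (section f B) s Z) (blockRate≤1 (section f B) s Z)
    (probed≤1 f s Bs Z (moved f B Z W) F≤1)

  0≤roundRate : ∀ {n} {f : BoolFun n} → Nonempty f → ∀ s Bs → 0ℚ ≤ roundRate f s Bs
  0≤roundRate {n} {f} ne s Bs = 𝔼-≥ (cube n) λ Z → 0≤probed f s Bs Z Z (0≤stay ne)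

  roundRate≤1 : ∀ {n} {f : BoolFun n} → Nonempty f → ∀ s Bs → roundRate f s Bs ≤ 1ℚ
  roundRate≤1 {n} {f} ne s Bs = 𝔼-≤ (cube n) λ Z → probed≤1 f s Bs Z Z (stay≤1 ne)

  accProb-search-≤ : ∀ {n b} (f : BoolFun n) (Ms : Vec (Cube n) b) x w X t {c} →
    (∀ B → accProb f (t B) ≤ c) → accProb f (search Ms x w X t) ≤ c
  accProb-search-≤ f []       x w X t le = le (block x X)
  accProb-search-≤ f (M ∷ Ms) x w X t le with f (x ⊕ (w ∩ M))
  ... | true  = accProb-search-≤ f Ms _ _ _ t le
  ... | false = accProb-search-≤ f Ms _ _ _ t le

  accProb-explore-≤ : ∀ {n b} {f : BoolFun n} → Nonempty f → ∀ (Ms : Vec (Cube n) b) r Bs t {c} →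
    (∀ Bs → accProb f (t Bs) ≤ c) → accProb f (explore Ms r Bs t) ≤ c
  accProb-explore-≤ ne Ms zero Bs t le = le Bs
  accProb-explore-≤ {n} {f = f} ne Ms (suc r) Bs t {c} le = 𝔼-≤ (sampleᴱ ne) λ x →
    ≤-trans (≤-reflexive (accProb-randomCube f n _)) (𝔼-≤ (cube n) λ w → outcome x w)
    where
    outcome : ∀ x w → accProb f (if f (x ⊕ (w ∩ free Bs)) then explore Ms r Bs t
      else search Ms x (w ∩ free Bs) (free Bs) (λ B → explore Ms r (B ∷ Bs) t)) ≤ c
    outcome x w with f (x ⊕ (w ∩ free Bs))
    ... | true  = accProb-explore-≤ ne Ms r Bs t le
    ... | false = accProb-search-≤ f Ms _ _ _ _ λ B → accProb-explore-≤ ne Ms r (B ∷ Bs) t le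

  -- The exploration only selects the list handed to `verify`, so a bound for every valid list
  -- bounds the average; an invalid list is rejected outright.
  soundness : ∀ {n k b r s m} {f : BoolFun n} {c} → Nonempty f → 0ℚ ≤ c →
    (∀ Bs → Valid k Bs → roundRate f s Bs ^ m ≤ c) → accProb f (tester n k b r s m) ≤ c
  soundness {n} {k} {b} {r} {s} {m} {f} {c} ne 0≤c valid-≤ =
    ≤-trans (≤-reflexive (accProb-randomCubes f n b _)) (𝔼-≤ (vecᴱ (cube n) b) λ Ms →
      accProb-explore-≤ ne Ms r [] _ verify-≤)
    where
    verify-≤ : ∀ Bs → accProb f (verify k s m Bs) ≤ c
    verify-≤ Bs = outcome (valid? k Bs)
      where
      outcome : (d : Dec (Valid k Bs)) → accProb f (if does d then verifyRounds s m Bs else halt false) ≤ c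
      outcome (yes v) = ≤-trans (≤-reflexive (accProb-verifyRounds ne s m Bs)) (valid-≤ Bs v)
      outcome (no  _) = 0≤c

  -- Influences and dictators

  𝟙-triangle : ∀ p q t → 𝟙 (p xor t) ≤ 𝟙 (p xor q) + 𝟙 (q xor t)
  𝟙-triangle false false t     = ≤-reflexive (sym (+-identityˡ _))
  𝟙-triangle false true  false = 0≤+ 0≤1 0≤1
  𝟙-triangle false true  true  = ≤-reflexive refl
  𝟙-triangle true  false false = ≤-reflexive refl
  𝟙-triangle true  false true  = 0≤+ 0≤1 0≤1
  𝟙-triangle true  true  t     = ≤-reflexive (sym (+-identityˡ _))

  -- For fixed `r`, adding `φ r` to `a` preserves the uniform measure.
  𝔼-shear : ∀ n (φ : Cube n → Cube n) (G : Cube n → Cube n → ℚ) →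
    𝔼 (cube n) (λ a → 𝔼 (cube n) λ r → G (a ⊕ φ r) r) ≡ 𝔼 (cube n) (λ a → 𝔼 (cube n) (G a))
  𝔼-shear n φ G = trans (𝔼-swap (cube n) n _)
    (trans (𝔼-cong (cube n) λ r → 𝔼-shift n (φ r) (λ a → G a r)) (sym (𝔼-swap (cube n) n _)))

  -- Along the chain of initial segments from `∅` to `⊤`, `P` must turn from false to true at some
  -- coordinate.
  switching-coordinate : ∀ {n} {P : Cube n → Set} → (∀ Y → Dec (P Y)) → P ⊤ → ¬ P ∅ →
    ∃[ Y ] ∃[ i ] ¬ P Y × P (Y ⊕ ⁅ i ⁆)
  switching-coordinate {zero}  P? p⊤ ¬p∅ = contradiction p⊤ ¬p∅
  switching-coordinate {suc n} {P} P? p⊤ ¬p∅ with P? (true ∷ ∅)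
  ... | yes p = ∅ , zero , ¬p∅ , subst P (cong (true ∷_) (cube-id :∅ (:∅ :⊕ :∅) [])) p
  ... | no ¬p = let Y , i , ¬pY , pYi = switching-coordinate (P? ∘ (true ∷_)) p⊤ ¬p
                in true ∷ Y , suc i , ¬pY , pYi

  singleton-lookup : ∀ {n} (i : Fin n) → lookup ⁅ i ⁆ i ≡ true
  singleton-lookup zero    = refl
  singleton-lookup (suc i) = singleton-lookup i

  singleton-lookup-≢ : ∀ {n} {i j : Fin n} → i ≢ j → lookup ⁅ i ⁆ j ≡ false
  singleton-lookup-≢ {i = zero}  {zero}  i≢j = contradiction refl i≢j
  singleton-lookup-≢ {i = zero}  {suc j} i≢j = Vec.lookup-replicate j false
  singleton-lookup-≢ {i = suc i} {zero}  i≢j = refl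
  singleton-lookup-≢ {i = suc i} {suc j} i≢j = singleton-lookup-≢ (i≢j ∘ cong suc)

  singleton-∩ : ∀ {n} (i : Fin n) (O : Cube n) → lookup O i ≡ true → ⁅ i ⁆ ∩ O ≡ ⁅ i ⁆
  singleton-∩ i O Oi = lookup-ext λ j → trans (lookup-∩ ⁅ i ⁆ O j) (at-coordinate j (i Fin.≟ j))
    where
    at-coordinate : ∀ j → Dec (i ≡ j) → lookup ⁅ i ⁆ j ∧ᵇ lookup O j ≡ lookup ⁅ i ⁆ j
    at-coordinate .i (yes refl) = trans (cong (lookup ⁅ i ⁆ i ∧ᵇ_) Oi) (𝔹.∧-identityʳ _)
    at-coordinate j  (no i≢j) rewrite singleton-lookup-≢ i≢j = refl

  -- Chosen together: passing to a subset doubles the bound `δ`, and two such pieces make `⅛`, which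
  -- is 4δ; two sets at `⅛` make `¼`. `⅓` allows a union bound over three sets, and `¾` satisfies 1
  -- - ¾ · ⅓ = ¾.
  ¼ δ ⅛ ⅓ ¾ : ℚ
  δ = ℤ.+ 1 / 32
  ⅛ = ℤ.+ 1 / 8
  ¼ = ℤ.+ 1 / 4
  ⅓ = ℤ.+ 1 / 3
  ¾ = ℤ.+ 3 / 4

  neither : ∀ {A B : Set} → Dec A → Dec B → Bool
  neither a? b? = not (does a?) ∧ᵇ not (does b?)

  neither-false : ∀ {A B : Set} (a? : Dec A) (b? : Dec B) → 𝟙 (neither a? b?) < 1ℚ → A ⊎ B
  neither-false (yes a) _       _  = inj₁ a
  neither-false (no _)  (yes b) _  = inj₂ b
  neither-false (no _)  (no _)  lt = ⊥-elim (<-irrefl refl lt)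

  neither-≤ : ∀ {A B : Set} (a? : Dec A) (b? : Dec B) {x} → x ≤ 1ℚ → (¬ A → ¬ B → x ≤ ¼) →
    x ≤ 1ℚ - ¾ * 𝟙 (neither a? b?)
  neither-≤ (yes _) _       x≤1 _  = x≤1
  neither-≤ (no _)  (yes _) x≤1 _  = x≤1
  neither-≤ (no ¬a) (no ¬b) _   le = le ¬a ¬b

  module Influence {n} (h : BoolFun n) where

    changes : Cube n → Cube n → Cube n → ℚ
    changes P a r = 𝟙 (h a xor h (a ⊕ (r ∩ P)))

    -- Rerandomising P, rather than flipping it, makes influence monotone up to a factor 2.
    influence : Cube n → ℚ
    influence P = 𝔼 (cube n) λ a → 𝔼 (cube n) λ r → changes P a r

    -- The same `r` rerandomises first `P`, then `Q`; by the shear the second step again starts at a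
    -- uniform point.
    influence-⊕ : ∀ P Q → influence (P ⊕ Q) ≤ influence P + influence Q
    influence-⊕ P Q = ≤-trans
      (𝔼-≤+ (cube n) λ a → 𝔼-≤+ (cube n) λ r → ≤-trans
        (≤-reflexive (cong (λ y → 𝟙 (h a xor h y))
          (cube-id (v₀ :⊕ v₁ :∩ (v₂ :⊕ v₃)) (v₀ :⊕ v₁ :∩ v₂ :⊕ v₁ :∩ v₃) (a ∷ r ∷ P ∷ Q ∷ []))))
        (𝟙-triangle (h a) (h (a ⊕ (r ∩ P))) _))
      (+-monoʳ-≤ (influence P) (≤-reflexive (𝔼-shear n (_∩ P) (changes Q))))

    influence-∅ : influence ∅ ≡ 0ℚ
    influence-∅ = trans
      (𝔼-cong (cube n) λ a → trans (𝔼-cong (cube n) λ r →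
        trans (cong (λ y → 𝟙 (h a xor h y)) (cube-id (v₀ :⊕ v₁ :∩ :∅) v₀ (a ∷ r ∷ [])))
          (cong 𝟙 (𝔹.xor-same (h a))))
        (𝔼-const (cube n) 0ℚ))
      (𝔼-const (cube n) 0ℚ)

    -- Both ends are compared with `a ⊕ (r′ ∩ Q)` for a fresh `r′`. As `P` lies in `Q`, this point
    -- is a rerandomisation of `Q` seen from either end.
    influence-⊆ : ∀ P Q → P ∩ Q ≡ P → influence P ≤ influence Q + influence Q
    influence-⊆ P Q P⊆Q = ≤-trans
      (𝔼-≤+ (cube n) {G = λ a → 𝔼 (cube n) (changes Q a)} {H = λ a → 𝔼 (cube n) λ r → 𝔼 (cube n) (second a r)} λ a →
        ≤-trans (𝔼-≤+ (cube n) {G = λ r → 𝔼 (cube n) (changes Q a)} {H = λ r → 𝔼 (cube n) (second a r)} λ r →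
          ≤-trans (≤-reflexive (sym (𝔼-const (cube n) (changes P a r)))) (𝔼-≤+ (cube n) λ r′ →
            𝟙-triangle (h a) (h (a ⊕ (r′ ∩ Q))) _))
        (+-monoˡ-≤ _ (≤-reflexive (𝔼-const (cube n) (𝔼 (cube n) (changes Q a))))))
      (+-monoʳ-≤ (influence Q) (≤-reflexive (trans
        (𝔼-cong (cube n) λ a → 𝔼-cong (cube n) λ r → trans (𝔼-cong (cube n) λ r′ → recentre a r r′)
          (𝔼-shift n (r ∩ P) (changes Q (a ⊕ (r ∩ P)))))
        (trans (𝔼-shear n (_∩ P) (λ a _ → 𝔼 (cube n) (changes Q a)))
          (𝔼-cong (cube n) λ a → 𝔼-const (cube n) (𝔼 (cube n) (changes Q a)))))))
      where
      second : Cube n → Cube n → Cube n → ℚ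
      second a r r′ = 𝟙 (h (a ⊕ (r′ ∩ Q)) xor h (a ⊕ (r ∩ P)))
      recentre : ∀ a r r′ → second a r r′ ≡ changes Q (a ⊕ (r ∩ P)) (r′ ⊕ (r ∩ P))
      recentre a r r′ = trans (cong 𝟙 (𝔹.xor-comm (h (a ⊕ (r′ ∩ Q))) (h (a ⊕ (r ∩ P)))))
        (cong (λ y → 𝟙 (h (a ⊕ (r ∩ P)) xor h y)) (subst
          (λ P′ → a ⊕ (r′ ∩ Q) ≡ (a ⊕ (r ∩ P′)) ⊕ ((r′ ⊕ (r ∩ P′)) ∩ Q)) P⊆Q
          (cube-id (v₀ :⊕ v₂ :∩ v₄) ((v₀ :⊕ v₁ :∩ (v₃ :∩ v₄)) :⊕ (v₂ :⊕ v₁ :∩ (v₃ :∩ v₄)) :∩ v₄)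
            (a ∷ r ∷ r′ ∷ P ∷ Q ∷ []))))

    antipodal : ℚ
    antipodal = 𝔼 (cube n) λ a → 𝟙 (h a xor h (∁ a))

    -- A fresh uniform point is a full rerandomisation both of `a` and of its antipode.
    antipodal-≤ : antipodal ≤ influence ⊤ + influence ⊤
    antipodal-≤ = ≤-trans
      (𝔼-≤+ (cube n) λ a → ≤-trans (≤-reflexive (sym (𝔼-const (cube n) (𝟙 (h a xor h (∁ a))))))
        (𝔼-≤+ (cube n) λ r → 𝟙-triangle (h a) (h (a ⊕ (r ∩ ⊤))) _))
      (+-monoʳ-≤ (influence ⊤) (≤-reflexive (trans
        (𝔼-cong (cube n) λ a → trans (𝔼-cong (cube n) λ r → recentre a r)
          (𝔼-shift n ⊤ (changes ⊤ (a ⊕ ⊤))))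
        (𝔼-shift n ⊤ (λ a → 𝔼 (cube n) (changes ⊤ a))))))
      where
      recentre : ∀ a r → 𝟙 (h (a ⊕ (r ∩ ⊤)) xor h (∁ a)) ≡ changes ⊤ (a ⊕ ⊤) (r ⊕ ⊤)
      recentre a r = trans (cong 𝟙 (𝔹.xor-comm (h (a ⊕ (r ∩ ⊤))) (h (∁ a))))
        (cong₂ (λ y z → 𝟙 (h y xor h z)) (cube-id (:∁ v₀) (v₀ :⊕ :⊤) (a ∷ []))
          (cube-id (v₀ :⊕ v₁ :∩ :⊤) (v₀ :⊕ :⊤ :⊕ (v₁ :⊕ :⊤) :∩ :⊤) (a ∷ r ∷ [])))

    passRate-≤-1-influence : ∀ O → passRate h O ≤ 1ℚ - influence O
    passRate-≤-1-influence O = ≤-trans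
      (mono (cube n) λ a → ≤-trans (mono (cube n) λ r → pointwise (h a) _ _)
        (≤-reflexive (𝔼-complement (cube n) (changes O a))))
      (≤-reflexive (𝔼-complement (cube n) _))
      where
      pointwise : ∀ p q q′ → 𝟙 (not (p xor q) ∧ᵇ (p xor q′)) ≤ 1ℚ - 𝟙 (p xor q)
      pointwise p q q′ with p xor q
      ... | true  = ≤-reflexive refl
      ... | false = 𝟙≤1 (p xor q′)

    passRate-≤-antipodal : ∀ O → passRate h O ≤ antipodal
    passRate-≤-antipodal O = mono (cube n) λ a → 𝔼-≤ (cube n) λ r → pointwise (h a) _ _
      where
      pointwise : ∀ p q q′ → 𝟙 (not (p xor q) ∧ᵇ (p xor q′)) ≤ 𝟙 (p xor q′)
      pointwise p q q′ with p xor q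
      ... | true  = 0≤𝟙 (p xor q′)
      ... | false = ≤-refl

    Small Essential Good : Cube n → Set
    Small P     = influence P ≤ δ
    Essential Y = influence (∁ Y) ≤ ⅛
    Good Z      = Small Z ⊎ Small (∁ Z)

    small? : ∀ P → Dec (Small P)
    small? P = influence P ≤? δ

    bad : Cube n → Bool
    bad Z = neither (small? Z) (small? (∁ Z))

    ¬bad⇒good : ∀ Z → 𝟙 (bad Z) < 1ℚ → Good Z
    ¬bad⇒good Z = neither-false (small? Z) (small? (∁ Z))

    -- Outside `Y` the sets `P` and `P ⊕ Y` agree, so `P` and `∁ (P ⊕ Y)` cut `∁ Y` into two pieces
    -- of influence at most 2δ each.
    essential-between : ∀ P Y → Small P → Small (∁ (P ⊕ Y)) → Essential Y
    essential-between P Y sP sQ = ≤-trans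
      (≤-reflexive (cong influence (cube-id (:∁ v₁) (v₀ :∩ :∁ v₁ :⊕ :∁ (v₀ :⊕ v₁) :∩ :∁ v₁) (P ∷ Y ∷ []))))
      (≤-trans (influence-⊕ _ _) (+-mono-≤ (part P sP) (part (∁ (P ⊕ Y)) sQ)))
      where
      part : ∀ Q → Small Q → influence (Q ∩ ∁ Y) ≤ δ + δ
      part Q sQ = ≤-trans (influence-⊆ (Q ∩ ∁ Y) Q
        (cube-id (v₀ :∩ :∁ v₁ :∩ v₀) (v₀ :∩ :∁ v₁) (Q ∷ Y ∷ []))) (+-mono-≤ sQ sQ)

    -- Walk R, R ⊕ Y₁, R ⊕ Y₁ ⊕ Y₂, ∁ R: between two consecutive sets on different sides one piece
    -- of the partition Y₁, Y₂, ∁ (Y₁ ⊕ Y₂) is crossed, and that piece is essential.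
    essential-piece : 𝔼 (cube n) (𝟙 ∘ bad) < ⅓ → ∀ Y₁ Y₂ →
      Essential Y₁ ⊎ Essential Y₂ ⊎ Essential (∁ (Y₁ ⊕ Y₂))
    essential-piece few-bad Y₁ Y₂ = walk (¬bad⇒good R below₁) (¬bad⇒good (R ⊕ Y₁) below₂) (¬bad⇒good (R ⊕ (Y₁ ⊕ Y₂)) below₃)
      where
      b₁ b₂ b₃ : Cube n → ℚ
      b₁ R = 𝟙 (bad R)
      b₂ R = 𝟙 (bad (R ⊕ Y₁))
      b₃ R = 𝟙 (bad (R ⊕ (Y₁ ⊕ Y₂)))
      -- Each of the three points of the walk is uniform, so some `R` makes none of them bad.
      total : 𝔼 (cube n) (λ R → b₁ R + (b₂ R + b₃ R)) < 1ℚ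
      total = ≤-<-trans (≤-reflexive (trans (additive (cube n) b₁ (λ R → b₂ R + b₃ R))
        (cong (𝔼 (cube n) b₁ +_) (trans (additive (cube n) b₂ b₃)
          (cong₂ _+_ (𝔼-shift n Y₁ (𝟙 ∘ bad)) (𝔼-shift n (Y₁ ⊕ Y₂) (𝟙 ∘ bad)))))))
        (+-mono-< few-bad (+-mono-< few-bad few-bad))
      R : Cube n
      R = proj₁ (∃-below-𝔼 n _ total)
      sum<1 : b₁ R + (b₂ R + b₃ R) < 1ℚ
      sum<1 = proj₂ (∃-below-𝔼 n _ total)
      below₁ : 𝟙 (bad R) < 1ℚ
      below₁ = ≤-<-trans (≤-by (0≤+ (0≤𝟙 (bad (R ⊕ Y₁))) (0≤𝟙 (bad (R ⊕ (Y₁ ⊕ Y₂))))) (step (b₁ R) (b₂ R + b₃ R))) sum<1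
        where
        step : ∀ a b → a + b ≡ (a + b) + 0ℚ
        step = solve-∀ ℚ-ring
      below₂ : 𝟙 (bad (R ⊕ Y₁)) < 1ℚ
      below₂ = ≤-<-trans (≤-by (0≤+ (0≤𝟙 (bad R)) (0≤𝟙 (bad (R ⊕ (Y₁ ⊕ Y₂))))) (step (b₁ R) (b₂ R) (b₃ R))) sum<1
        where
        step : ∀ a b c → b + (a + c) ≡ (a + (b + c)) + 0ℚ
        step = solve-∀ ℚ-ring
      below₃ : 𝟙 (bad (R ⊕ (Y₁ ⊕ Y₂))) < 1ℚ
      below₃ = ≤-<-trans (≤-by (0≤+ (0≤𝟙 (bad R)) (0≤𝟙 (bad (R ⊕ Y₁)))) (step (b₁ R) (b₂ R) (b₃ R))) sum<1
        where
        step : ∀ a b c → c + (a + b) ≡ (a + (b + c)) + 0ℚ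
        step = solve-∀ ℚ-ring
      walk : Good R → Good (R ⊕ Y₁) → Good (R ⊕ (Y₁ ⊕ Y₂)) →
        Essential Y₁ ⊎ Essential Y₂ ⊎ Essential (∁ (Y₁ ⊕ Y₂))
      walk (inj₁ r) (inj₂ s) _ = inj₁ (essential-between R Y₁ r s)
      walk (inj₁ r) (inj₁ s) (inj₂ t) = inj₂ (inj₁ (essential-between (R ⊕ Y₁) Y₂ s
        (subst Small (cube-id (:∁ (v₀ :⊕ (v₁ :⊕ v₂))) (:∁ (v₀ :⊕ v₁ :⊕ v₂)) (R ∷ Y₁ ∷ Y₂ ∷ [])) t)))
      walk (inj₁ r) (inj₁ s) (inj₁ t) = inj₂ (inj₂ (essential-between (R ⊕ (Y₁ ⊕ Y₂)) (∁ (Y₁ ⊕ Y₂)) t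
        (subst Small (cube-id v₀ (:∁ (v₀ :⊕ (v₁ :⊕ v₂) :⊕ :∁ (v₁ :⊕ v₂))) (R ∷ Y₁ ∷ Y₂ ∷ [])) r)))
      walk (inj₂ r) _ (inj₂ t) = inj₂ (inj₂ (essential-between (∁ R) (∁ (Y₁ ⊕ Y₂)) r
        (subst Small (cube-id (:∁ (v₀ :⊕ (v₁ :⊕ v₂))) (:∁ (:∁ v₀ :⊕ :∁ (v₁ :⊕ v₂))) (R ∷ Y₁ ∷ Y₂ ∷ [])) t)))
      walk (inj₂ r) (inj₂ s) (inj₁ t) = inj₂ (inj₁ (essential-between (R ⊕ (Y₁ ⊕ Y₂)) Y₂ t
        (subst Small (cube-id (:∁ (v₀ :⊕ v₁)) (:∁ (v₀ :⊕ (v₁ :⊕ v₂) :⊕ v₂)) (R ∷ Y₁ ∷ Y₂ ∷ [])) s)))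
      walk (inj₂ r) (inj₁ s) (inj₁ t) = inj₁ (essential-between (R ⊕ Y₁) Y₁ s
        (subst Small (cube-id (:∁ v₀) (:∁ (v₀ :⊕ v₁ :⊕ v₁)) (R ∷ Y₁ ∷ [])) r))

    -- Take `Y` just before the switching coordinate `τ`. Of the pieces `Y`, `⁅ τ ⁆` and the rest,
    -- `Y` is not essential, and neither is the rest, because `Y ⊕ ⁅ τ ⁆` is: two complementary
    -- essential sets would leave `⊤` influence at most `¼`.
    exists-essential : 𝔼 (cube n) (𝟙 ∘ bad) < ⅓ → ¼ < influence ⊤ → ∃[ τ ] Essential ⁅ τ ⁆
    exists-essential few-bad ¼<⊤ = conclude (switching-coordinate {P = Essential} (λ Y → influence (∁ Y) ≤? ⅛) ess-⊤ ¬ess-∅)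
      where
      ess-⊤ : Essential ⊤
      ess-⊤ = ≤-trans (≤-reflexive (trans (cong influence (cube-id (:∁ :⊤) :∅ [])) influence-∅)) (nonNegative⁻¹ ⅛)
      ¬ess-∅ : ¬ Essential ∅
      ¬ess-∅ le = <-irrefl refl (<-≤-trans ¼<⊤ (≤-trans (≤-reflexive (cong influence (cube-id :⊤ (:∁ :∅) [])))
        (≤-trans le (toWitness {a? = ⅛ ≤? ¼} tt))))
      conclude : ∃[ Y ] ∃[ τ ] ¬ Essential Y × Essential (Y ⊕ ⁅ τ ⁆) → ∃[ τ ] Essential ⁅ τ ⁆
      conclude (Y , τ , ¬eY , eY⊕τ) = cases (essential-piece few-bad Y ⁅ τ ⁆)
        where
        cases : Essential Y ⊎ Essential ⁅ τ ⁆ ⊎ Essential (∁ (Y ⊕ ⁅ τ ⁆)) → ∃[ τ ] Essential ⁅ τ ⁆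
        cases (inj₁ eY)        = contradiction eY ¬eY
        cases (inj₂ (inj₁ eτ)) = τ , eτ
        cases (inj₂ (inj₂ eR)) = ⊥-elim (<-irrefl refl (<-≤-trans ¼<⊤ (≤-trans
          (≤-reflexive (cong influence (cube-id :⊤ (:∁ (:∁ v₀) :⊕ :∁ v₀) (Y ⊕ ⁅ τ ⁆ ∷ []))))
          (≤-trans (influence-⊕ (∁ (∁ (Y ⊕ ⁅ τ ⁆))) (∁ (Y ⊕ ⁅ τ ⁆))) (+-mono-≤ eR eY⊕τ)))))

    record Dictated : Set where
      field
        τ        : Fin n
        relevant : 0ℚ < influence ⁅ τ ⁆
        rejects  : ∀ O → lookup O τ ≡ true → passRate h O ≤ 1ℚ - δ

    -- The variables other than `τ` carry at most `⅛` of more than `¼`, so `τ` carries more than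
    -- `⅛`, and every `O` containing it carries more than half of that, hence at least `δ`.
    essential⇒dictated : ∀ {τ} → ¼ < influence ⊤ → Essential ⁅ τ ⁆ → Dictated
    essential⇒dictated {τ} ¼<⊤ eτ = record
      { τ        = τ
      ; relevant = ≤-<-trans (nonNegative⁻¹ ⅛) ⅛<τ
      ; rejects  = λ O Oτ → ≤-trans (passRate-≤-1-influence O) (+-monoʳ-≤ 1ℚ (neg-antimono-≤ (δ≤ O Oτ)))
      }
      where
      ⅛<τ : ⅛ < influence ⁅ τ ⁆
      ⅛<τ with influence ⁅ τ ⁆ ≤? ⅛
      ... | no ≰ = ≰⇒> ≰
      ... | yes le = ⊥-elim (<-irrefl refl (<-≤-trans ¼<⊤ (≤-trans
        (≤-reflexive (cong influence (cube-id :⊤ (v₀ :⊕ :∁ v₀) (⁅ τ ⁆ ∷ []))))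
        (≤-trans (influence-⊕ _ _) (+-mono-≤ le eτ)))))
      δ≤ : ∀ O → lookup O τ ≡ true → δ ≤ influence O
      δ≤ O Oτ with influence O ≤? δ
      ... | no ≰ = <⇒≤ (≰⇒> ≰)
      ... | yes le = ⊥-elim (<-irrefl refl (<-≤-trans ⅛<τ (≤-trans
        (influence-⊆ ⁅ τ ⁆ O (singleton-∩ τ O Oτ)) (≤-trans (+-mono-≤ le le) (toWitness {a? = δ + δ ≤? ⅛} tt)))))

    -- Little total influence fails the antipodal comparison; many bad `Z` are caught by the checks
    -- on either side; otherwise a dictator exists.
    blockRate-dichotomy : ∀ s → (1ℚ - δ) ^ suc s ≤ ¼ →
      𝔼 (cube n) (blockRate h (suc s)) ≤ ¾ ⊎ Dictated
    blockRate-dichotomy s small with ¼ <? influence ⊤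
    -- Here a single check suffices, which is why the exponent is a successor.
    ... | no ≮ = inj₁ (𝔼-≤ (cube n) λ Z → ≤-trans
          (^-suc-≤ (0≤passRate h (side (hit h Z) Z)) (passRate≤1 h (side (hit h Z) Z)) s)
          (≤-trans (passRate-≤-antipodal (side (hit h Z) Z)) (≤-trans antipodal-≤
          (≤-trans (+-mono-≤ (≮⇒≥ ≮) (≮⇒≥ ≮)) (toWitness {a? = ¼ + ¼ ≤? ¾} tt)))))
    ... | yes ¼<⊤ with 𝔼 (cube n) (𝟙 ∘ bad) <? ⅓
    ...   | yes few-bad = inj₂ (essential⇒dictated ¼<⊤ (proj₂ (exists-essential few-bad ¼<⊤)))
    ...   | no ≮ = inj₁ (≤-trans (mono (cube n) pointwise) (≤-trans (≤-reflexive
            (trans (𝔼-complement (cube n) (λ Z → ¾ * 𝟙 (bad Z))) (cong (λ p → 1ℚ - p) (homogeneous (cube n) ¾ (𝟙 ∘ bad)))))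
            (+-monoʳ-≤ 1ℚ (neg-antimono-≤ (scale-≤ (nonNegative⁻¹ ¾) (≮⇒≥ ≮))))))
      where
      influential : ∀ O → ¬ Small O → passRate h O ^ suc s ≤ ¼
      influential O ¬s = ≤-trans (^-mono (0≤passRate h O)
        (≤-trans (passRate-≤-1-influence O) (+-monoʳ-≤ 1ℚ (neg-antimono-≤ (<⇒≤ (≰⇒> ¬s))))) (suc s)) small
      pointwise : ∀ Z → blockRate h (suc s) Z ≤ 1ℚ - ¾ * 𝟙 (bad Z)
      pointwise Z = neither-≤ (small? Z) (small? (∁ Z)) (blockRate≤1 h (suc s) Z) λ ¬s ¬s′ →
        rate-≤ (hit h Z) ¬s ¬s′
        where
        rate-≤ : ∀ d → ¬ Small Z → ¬ Small (∁ Z) → passRate h (side d Z) ^ suc s ≤ ¼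
        rate-≤ false ¬s ¬s′ = influential Z ¬s
        rate-≤ true  ¬s ¬s′ = influential (∁ Z) ¬s′

  open Influence using (Dictated; module Dictated)

  -- Soundness

  drift : ∀ {n} → BoolFun n → Cube n → ℚ
  drift {n} f m = 1ℚ - 𝔼 (cube n) λ Z → stay f (Z ∩ m)

  𝟙-not : ∀ b → 𝟙 (not b) ≡ 1ℚ - 𝟙 b
  𝟙-not false = refl
  𝟙-not true  = refl

  𝟙-xor : ∀ p q → 𝟙 (p xor q) ≡ 𝟙 p * (1ℚ - 𝟙 q) + 𝟙 q * (1ℚ - 𝟙 p)
  𝟙-xor false false = refl
  𝟙-xor false true  = refl
  𝟙-xor true  false = refl
  𝟙-xor true  true  = refl

  -- A pair on which `f` differs either leaves or enters f⁻¹(1); the shear undoing the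
  -- rerandomisation shows that both kinds have equal weight.
  influence-drift : ∀ {n} {f : BoolFun n} → Nonempty f → ∀ m →
    Influence.influence f m ≡ (density f + density f) * drift f m
  influence-drift {n} {f} ne m = trans
    (𝔼-cong (cube n) λ a → trans (𝔼-cong (cube n) λ r → 𝟙-xor (f a) (f (a ⊕ (r ∩ m))))
      (additive (cube n) (leave a) (λ r → 𝟙 (f (a ⊕ (r ∩ m))) * (1ℚ - 𝟙 (f a)))))
    (trans (additive (cube n) _ _)
    (trans (cong₂ _+_ leave-drift (trans return leave-drift)) (sym (*-distribʳ-+ (drift f m) (density f) (density f)))))
    where
    leave : Cube n → Cube n → ℚ
    leave a r = 𝟙 (f a) * (1ℚ - 𝟙 (f (a ⊕ (r ∩ m))))
    return : 𝔼 (cube n) (λ a → 𝔼 (cube n) λ r → 𝟙 (f (a ⊕ (r ∩ m))) * (1ℚ - 𝟙 (f a)))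
           ≡ 𝔼 (cube n) (λ a → 𝔼 (cube n) (leave a))
    return = trans
      (𝔼-cong (cube n) λ a → 𝔼-cong (cube n) λ r → cong (λ y → 𝟙 (f (a ⊕ (r ∩ m))) * (1ℚ - 𝟙 (f y)))
        (cube-id v₀ (v₀ :⊕ v₁ :∩ v₂ :⊕ v₁ :∩ v₂) (a ∷ r ∷ m ∷ [])))
      (𝔼-shear n (_∩ m) leave)
    leave-drift : 𝔼 (cube n) (λ a → 𝔼 (cube n) (leave a)) ≡ density f * drift f m
    leave-drift = trans (𝔼-swap (cube n) n leave)
      (trans (𝔼-cong (cube n) λ r → trans (sym (density-*-mean f (λ x → 1ℚ - 𝟙 (f (x ⊕ (r ∩ m))))))
        (cong (density f *_) (𝔼-complement (sampleᴱ ne) (λ x → 𝟙 (f (x ⊕ (r ∩ m)))))))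
      (trans (homogeneous (cube n) (density f) (λ r → 1ℚ - stay f (r ∩ m)))
        (cong (density f *_) (𝔼-complement (cube n) (λ r → stay f (r ∩ m))))))

  ∈⇒lookup : ∀ {n} {S : Cube n} {i} → i ∈ₛ S → lookup S i ≡ true
  ∈⇒lookup = Vec.[]=⇒lookup

  lookup⇒∈ : ∀ {n} {S : Cube n} {i} → lookup S i ≡ true → i ∈ₛ S
  lookup⇒∈ {S = S} {i} = Vec.lookup⇒[]= i S

  -- Distance to the junta given by majority vote

  module Majority {n} (f : BoolFun n) (S : Cube n) where

    vote : Cube n → ℚ
    vote u = 𝔼 (cube n) λ Z → 𝟙 (f (u ⊕ (Z ∩ ∁ S)))

    majority : BoolFun n
    majority x = does (½ ≤? vote (x ∩ S))

    majority-junta : ∀ {k} → ∣ S ∣ ℕ.≤ k → IsJunta k majority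
    majority-junta ∣S∣≤k = S , ∣S∣≤k , λ x y agree → cong (λ u → does (½ ≤? vote u)) (lookup-ext λ i →
      trans (lookup-∩ x S i) (trans (on-S x y agree i) (sym (lookup-∩ y S i))))
      where
      on-S : ∀ x y → (∀ i → i ∈ₛ S → lookup x i ≡ lookup y i) → ∀ i → lookup x i ∧ᵇ lookup S i ≡ lookup y i ∧ᵇ lookup S i
      on-S x y agree i with lookup S i in eq
      ... | true  = cong (_∧ᵇ true) (agree i (lookup⇒∈ eq))
      ... | false = trans (𝔹.∧-zeroʳ _) (sym (𝔹.∧-zeroʳ _))

    disagreement : Cube n → ℚ
    disagreement x = 𝔼 (cube n) (λ Z → 𝟙 (f x xor f ((x ∩ S) ⊕ (Z ∩ ∁ S))))

    -- Markov: where `f` and the majority differ, at least half of the votes differ from `f x`.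
    vote-≤ : ∀ x → 𝟙 (f x xor majority x) ≤ disagreement x + disagreement x
    vote-≤ x = by-value (f x) refl
      where
      by-value : ∀ b → f x ≡ b → 𝟙 (f x xor majority x) ≤ disagreement x + disagreement x
      by-value false fx rewrite fx = decide (½ ≤? vote (x ∩ S))
        where
        decide : (d : Dec (½ ≤ vote (x ∩ S))) → 𝟙 (does d) ≤ vote (x ∩ S) + vote (x ∩ S)
        decide (yes le) = +-mono-≤ le le
        decide (no _)   = let 0≤v = 𝔼-≥ (cube n) (λ Z → 0≤𝟙 (f ((x ∩ S) ⊕ (Z ∩ ∁ S)))) in 0≤+ 0≤v 0≤v
      by-value true fx rewrite fx = decide (½ ≤? vote (x ∩ S))
        where
        rest : ℚ
        rest = 𝔼 (cube n) λ Z → 𝟙 (not (f ((x ∩ S) ⊕ (Z ∩ ∁ S))))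
        rest≡ : rest ≡ 1ℚ - vote (x ∩ S)
        rest≡ = trans (𝔼-cong (cube n) λ Z → 𝟙-not (f ((x ∩ S) ⊕ (Z ∩ ∁ S)))) (𝔼-complement (cube n) _)
        decide : (d : Dec (½ ≤ vote (x ∩ S))) → 𝟙 (not (does d)) ≤ rest + rest
        decide (yes _) = let 0≤r = 𝔼-≥ (cube n) (λ Z → 0≤𝟙 (not (f ((x ∩ S) ⊕ (Z ∩ ∁ S))))) in 0≤+ 0≤r 0≤r
        decide (no ≰)  = ≤-trans (+-mono-≤ half≤ half≤) (≤-reflexive (sym (cong₂ _+_ rest≡ rest≡)))
          where
          half≤ : ½ ≤ 1ℚ - vote (x ∩ S)
          half≤ = +-monoʳ-≤ 1ℚ (neg-antimono-≤ (<⇒≤ (≰⇒> ≰)))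

    mean-disagreement : 𝔼 (cube n) disagreement ≡ Influence.influence f (∁ S)
    mean-disagreement = 𝔼-cong (cube n) λ x → trans
      (sym (𝔼-shift n x (λ Z → 𝟙 (f x xor f ((x ∩ S) ⊕ (Z ∩ ∁ S))))))
      (𝔼-cong (cube n) λ Z → cong (λ y → 𝟙 (f x xor f y))
        (cube-id (v₀ :∩ v₂ :⊕ (v₁ :⊕ v₀) :∩ :∁ v₂) (v₀ :⊕ v₁ :∩ :∁ v₂) (x ∷ Z ∷ S ∷ [])))

    -- The 4 is 2 from Markov's bound times 2 from counting boundary pairs in both directions.
    relDist-majority : Nonempty f → relDist f majority ≤ ι 4 * drift f (∁ S)
    relDist-majority ne = 0<⇒*-cancelˡ-≤ (0<density ne) (≤-trans
      (≤-reflexive (trans (*-comm (density f) (relDist f majority)) (relDist-*-density f majority ne)))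
      (≤-trans (𝔼-≤+ (cube n) {G = disagreement} {H = disagreement} vote-≤)
      (≤-reflexive (trans (cong₂ _+_ eq eq) (step (density f) (drift f (∁ S)))))))
      where
      eq : 𝔼 (cube n) disagreement ≡ (density f + density f) * drift f (∁ S)
      eq = trans mean-disagreement (influence-drift ne (∁ S))
      step : ∀ a b → (a + a) * b + (a + a) * b ≡ a * ((1ℚ + (1ℚ + (1ℚ + (1ℚ + 0ℚ)))) * b)
      step = solve-∀ ℚ-ring

  Far : ∀ {n} → ℕ → ℚ → BoolFun n → Set
  Far {n} k ε f = ∀ (g : BoolFun n) → IsJunta k g → ε ≤ relDist f g

  far-drift : ∀ {n k ε} {f : BoolFun n} → Nonempty f → Far k ε f → ∀ S → ∣ S ∣ ℕ.≤ k → ε ≤ ι 4 * drift f (∁ S)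
  far-drift {f = f} ne far S ∣S∣≤k = ≤-trans (far majority (majority-junta ∣S∣≤k)) (relDist-majority ne)
    where open Majority f S

  -- A section ignores the variables outside its cell, so none of them has positive influence.
  relevant⇒cell : ∀ {n} (f : BoolFun n) B τ → 0ℚ < Influence.influence (section f B) ⁅ τ ⁆ → lookup (cell B) τ ≡ true
  relevant⇒cell {n} f (block v X) τ 0<μ with lookup X τ in eq
  ... | true  = refl
  ... | false = ⊥-elim (<-irrefl (sym μ≡0) 0<μ)
    where
    outside : ∀ r → (r ∩ ⁅ τ ⁆) ∩ X ≡ ∅
    outside r = lookup-ext λ i → trans (lookup-∩ (r ∩ ⁅ τ ⁆) X i)
      (trans (cong (_∧ᵇ lookup X i) (lookup-∩ r ⁅ τ ⁆ i)) (trans (at-coordinate i (τ Fin.≟ i)) (sym (Vec.lookup-replicate i false))))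
      where
      at-coordinate : ∀ i → Dec (τ ≡ i) → (lookup r i ∧ᵇ lookup ⁅ τ ⁆ i) ∧ᵇ lookup X i ≡ false
      at-coordinate i (yes refl) = trans (cong ((lookup r i ∧ᵇ lookup ⁅ τ ⁆ i) ∧ᵇ_) eq) (𝔹.∧-zeroʳ _)
      at-coordinate i (no τ≢i) rewrite singleton-lookup-≢ τ≢i = cong (_∧ᵇ lookup X i) (𝔹.∧-zeroʳ (lookup r i))
    same : ∀ a r → v ⊕ ((a ⊕ (r ∩ ⁅ τ ⁆)) ∩ X) ≡ v ⊕ (a ∩ X)
    same a r = trans (cube-id (v₀ :⊕ (v₁ :⊕ v₂) :∩ v₃) (v₀ :⊕ (v₁ :∩ v₃ :⊕ v₂ :∩ v₃)) (v ∷ a ∷ (r ∩ ⁅ τ ⁆) ∷ X ∷ []))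
      (trans (cong (λ y → v ⊕ ((a ∩ X) ⊕ y)) (outside r)) (cube-id (v₀ :⊕ (v₁ :⊕ :∅)) (v₀ :⊕ v₁) (v ∷ a ∩ X ∷ [])))
    μ≡0 : Influence.influence (section f (block v X)) ⁅ τ ⁆ ≡ 0ℚ
    μ≡0 = trans (𝔼-cong (cube n) λ a → trans (𝔼-cong (cube n) λ r →
      trans (cong (λ y → 𝟙 (f (v ⊕ (a ∩ X)) xor f y)) (same a r)) (cong 𝟙 (𝔹.xor-same (f (v ⊕ (a ∩ X))))))
      (𝔼-const (cube n) 0ℚ)) (𝔼-const (cube n) 0ℚ)

  -- Pivots of the blocks and the sets flipped in a round

  ∣p∪q∣≤∣p∣+∣q∣ : ∀ {n} (p q : Subset n) → ∣ p ∪ q ∣ ℕ.≤ ∣ p ∣ ℕ.+ ∣ q ∣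
  ∣p∪q∣≤∣p∣+∣q∣ []          []          = z≤n
  ∣p∪q∣≤∣p∣+∣q∣ (true ∷ p)  (true ∷ q)  = s≤s (ℕ.≤-trans (∣p∪q∣≤∣p∣+∣q∣ p q) (ℕ.+-monoʳ-≤ ∣ p ∣ (ℕ.n≤1+n ∣ q ∣)))
  ∣p∪q∣≤∣p∣+∣q∣ (true ∷ p)  (false ∷ q) = s≤s (∣p∪q∣≤∣p∣+∣q∣ p q)
  ∣p∪q∣≤∣p∣+∣q∣ (false ∷ p) (true ∷ q)  = ℕ.≤-trans (s≤s (∣p∪q∣≤∣p∣+∣q∣ p q)) (ℕ.≤-reflexive (sym (ℕ.+-suc ∣ p ∣ ∣ q ∣)))
  ∣p∪q∣≤∣p∣+∣q∣ (false ∷ p) (false ∷ q) = ∣p∪q∣≤∣p∣+∣q∣ p q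

  lookup-∪ : ∀ {n} (x y : Cube n) i → lookup (x ∪ y) i ≡ lookup x i ∨ᵇ lookup y i
  lookup-∪ x y i = Vec.lookup-zipWith _∨ᵇ_ i x y

  toggle-⊕ : ∀ {n} d (X W V : Cube n) → toggle d X (W ⊕ V) ≡ toggle d X W ⊕ V
  toggle-⊕ false X W V = refl
  toggle-⊕ true  X W V = cube-id (v₁ :⊕ v₂ :⊕ v₀) (v₁ :⊕ v₀ :⊕ v₂) (X ∷ W ∷ V ∷ [])

  lookup-toggle : ∀ {n} d (X W : Cube n) i → lookup (toggle d X W) i ≡ lookup W i xor (d ∧ᵇ lookup X i)
  lookup-toggle false X W i = sym (𝔹.xor-identityʳ (lookup W i))
  lookup-toggle true  X W i = lookup-⊕ W X i

  lookup-free : ∀ {n} (B : Block n) Bs i → lookup (free (B ∷ Bs)) i ≡ lookup (free Bs) i ∧ᵇ not (lookup (cell B) i)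
  lookup-free B Bs i = trans (lookup-∩ (free Bs) (∁ (cell B)) i) (cong (lookup (free Bs) i ∧ᵇ_) (lookup-∁ (cell B) i))

  free⇒∉cell : ∀ {n} (B : Block n) Bs i → lookup (free (B ∷ Bs)) i ≡ true → lookup (free Bs) i ≡ true × lookup (cell B) i ≡ false
  free⇒∉cell B Bs i eq with lookup (free Bs) i | lookup (cell B) i | trans (sym (lookup-free B Bs i)) eq
  ... | true  | false | _ = refl , refl

  separated⇒free : ∀ {n} (B : Block n) Bs i → cell B ∩ free Bs ≡ cell B → lookup (cell B) i ≡ true → lookup (free Bs) i ≡ true
  separated⇒free B Bs i sep eq = trans (sym (cong (_∧ᵇ lookup (free Bs) i) eq))
    (trans (sym (lookup-∩ (cell B) (free Bs) i)) (trans (cong (λ X → lookup X i) sep) eq))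

  Pivot : ∀ {n} → Block n → Set
  Pivot {n} B = Σ (Fin n) λ τ → lookup (cell B) τ ≡ true

  module _ {n : ℕ} where

    support : ∀ {Bs : List (Block n)} → All Pivot Bs → Cube n
    support []                 = ∅
    support (_∷_ {x = B} d ds) = ⁅ proj₁ d ⁆ ∪ support ds

    ∣support∣≤ : ∀ {Bs : List (Block n)} (ds : All Pivot Bs) → ∣ support ds ∣ ℕ.≤ length Bs
    ∣support∣≤ []                 = ℕ.≤-reflexive (Subset.∣⊥∣≡0 n)
    ∣support∣≤ (_∷_ {x = B} d ds) = ℕ.≤-trans (∣p∪q∣≤∣p∣+∣q∣ ⁅ proj₁ d ⁆ (support ds))
      (ℕ.+-mono-≤ (ℕ.≤-reflexive (Subset.∣⁅x⁆∣≡1 (proj₁ d))) (∣support∣≤ ds))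

    -- The set that `probe` builds when every block answers according to its pivot.
    settle : ∀ {Bs : List (Block n)} → All Pivot Bs → Cube n → Cube n → Cube n
    settle []                 Z W = W
    settle (_∷_ {x = B} d ds) Z W = settle ds Z (toggle (lookup Z (proj₁ d)) (cell B) W)

    -- A shift missing the pivots changes no decision to toggle, and toggling is itself a shift.
    settle-⊕ : ∀ {Bs} (ds : All Pivot Bs) Z W V → (∀ i → lookup (support ds) i ≡ true → lookup V i ≡ false) →
      settle ds (Z ⊕ V) (W ⊕ V) ≡ settle ds Z W ⊕ V
    settle-⊕ []                 Z W V avoids = refl
    settle-⊕ (_∷_ {x = B} d ds) Z W V avoids = trans
      (cong (settle ds (Z ⊕ V)) (trans (cong (λ b → toggle b (cell B) (W ⊕ V)) Zτ) (toggle-⊕ (lookup Z τ) (cell B) W V)))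
      (settle-⊕ ds Z (toggle (lookup Z τ) (cell B) W) V λ i i∈ → avoids i
        (trans (lookup-∪ ⁅ τ ⁆ (support ds) i) (trans (cong (lookup ⁅ τ ⁆ i ∨ᵇ_) i∈) (𝔹.∨-zeroʳ _))))
      where
      τ = proj₁ d
      Zτ : lookup (Z ⊕ V) τ ≡ lookup Z τ
      Zτ = trans (lookup-⊕ Z V τ) (trans (cong (lookup Z τ xor_) (avoids τ
        (trans (lookup-∪ ⁅ τ ⁆ (support ds) τ) (cong (_∨ᵇ lookup (support ds) τ) (singleton-lookup τ)))))
        (𝔹.xor-identityʳ _))

    settle-free : ∀ {Bs} (ds : All Pivot Bs) Z W i → lookup (free Bs) i ≡ true →
      lookup (settle ds Z W) i ≡ lookup W i
    settle-free []                          Z W i _  = refl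
    settle-free (_∷_ {x = B} {xs = Bs} d ds) Z W i fr = let fr′ , i∉B = free⇒∉cell B Bs i fr in
      trans (settle-free ds Z (toggle (lookup Z (proj₁ d)) (cell B) W) i fr′) (trans (lookup-toggle (lookup Z (proj₁ d)) (cell B) W i)
        (trans (cong (λ b → lookup W i xor (lookup Z (proj₁ d) ∧ᵇ b)) i∉B)
          (trans (cong (lookup W i xor_) (𝔹.∧-zeroʳ _)) (𝔹.xor-identityʳ (lookup W i)))))

    support-split : ∀ {B Bs} (d : Pivot B) (ds : All Pivot Bs) i →
      lookup (support (_∷_ {x = B} d ds)) i ≡ true → proj₁ d ≡ i ⊎ lookup (support ds) i ≡ true
    support-split {B} d ds i eq with proj₁ d Fin.≟ i
    ... | yes τ≡i = inj₁ τ≡i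
    ... | no  τ≢i = inj₂ (trans (cong (_∨ᵇ lookup (support ds) i) (sym (singleton-lookup-≢ τ≢i)))
      (trans (sym (lookup-∪ ⁅ proj₁ d ⁆ (support ds) i)) eq))

    support⇒¬free : ∀ {Bs} (ds : All Pivot Bs) i → lookup (support ds) i ≡ true → lookup (free Bs) i ≡ false
    support⇒¬free []                           i eq with trans (sym eq) (Vec.lookup-replicate i false)
    ... | ()
    support⇒¬free (_∷_ {x = B} {xs = Bs} d ds) i eq with support-split {B} d ds i eq
    ... | inj₁ refl = trans (lookup-free B Bs i) (trans (cong (λ b → lookup (free Bs) i ∧ᵇ not b) (proj₂ d)) (𝔹.∧-zeroʳ _))
    ... | inj₂ i∈   = trans (lookup-free B Bs i) (cong (_∧ᵇ not (lookup (cell B) i)) (support⇒¬free ds i i∈))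

    -- The cells are disjoint, so a pivot is toggled by its own block only; starting from `W = Z`
    -- this clears it.
    settle-support : ∀ {Bs : List (Block n)} (ds : All Pivot Bs) → Separated Bs → ∀ Z W i → lookup (support ds) i ≡ true →
      lookup (settle ds Z W) i ≡ lookup W i xor lookup Z i
    settle-support [] _ Z W i eq with trans (sym eq) (Vec.lookup-replicate i false)
    ... | ()
    settle-support (_∷_ {x = B} {xs = Bs} d ds) (sep , seps) Z W i eq with support-split {B} d ds i eq
    ... | inj₁ refl = trans (settle-free ds Z (toggle (lookup Z i) (cell B) W) i (separated⇒free B Bs i sep (proj₂ d)))
      (trans (lookup-toggle (lookup Z i) (cell B) W i)
        (cong (lookup W i xor_) (trans (cong (lookup Z i ∧ᵇ_) (proj₂ d)) (𝔹.∧-identityʳ _))))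
    ... | inj₂ i∈ = trans (settle-support ds seps Z (toggle (lookup Z (proj₁ d)) (cell B) W) i i∈)
      (cong (_xor lookup Z i) (trans (lookup-toggle (lookup Z (proj₁ d)) (cell B) W i)
        (trans (cong (λ b → lookup W i xor (lookup Z (proj₁ d) ∧ᵇ b)) i∉B)
          (trans (cong (lookup W i xor_) (𝔹.∧-zeroʳ _)) (𝔹.xor-identityʳ (lookup W i))))))
      where
      i∉B : lookup (cell B) i ≡ false
      i∉B with lookup (cell B) i in c
      ... | false = refl
      ... | true  with trans (sym (separated⇒free B Bs i sep c)) (support⇒¬free ds i i∈)
      ...   | ()

    -- Z ↦ settle ds Z Z commutes with the shifts by Y ∩ m and has values below m, so averaging over such shifts makes the
    -- flipped set uniform among the sets missing the pivots.
    𝔼-settle : ∀ {Bs : List (Block n)} (ds : All Pivot Bs) → Separated Bs → ∀ F →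
      𝔼 (cube n) (λ Z → F (settle ds Z Z)) ≡ 𝔼 (cube n) (λ Z → F (Z ∩ ∁ (support ds)))
    𝔼-settle ds sep F = trans (sym (𝔼-const (cube n) (𝔼 (cube n) λ Z → F (settle ds Z Z))))
      (trans (𝔼-cong (cube n) λ Y → sym (𝔼-shift n (Y ∩ m) (λ Z → F (settle ds Z Z))))
      (trans (𝔼-swap (cube n) n (λ Y Z → F (settle ds (Z ⊕ (Y ∩ m)) (Z ⊕ (Y ∩ m)))))
      (trans (𝔼-cong (cube n) λ Z → trans (𝔼-cong (cube n) λ Y → cong F (absorb Z Y))
        (𝔼-shift n (settle ds Z Z) (λ Y → F (Y ∩ m))))
      (𝔼-const (cube n) (𝔼 (cube n) λ Y → F (Y ∩ m))))))
      where
      m = ∁ (support ds)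
      cleared : ∀ Z → settle ds Z Z ∩ m ≡ settle ds Z Z
      cleared Z = lookup-ext λ i → trans (lookup-∩ (settle ds Z Z) m i)
        (trans (cong (lookup (settle ds Z Z) i ∧ᵇ_) (lookup-∁ (support ds) i)) (at-coordinate i (lookup (support ds) i) refl))
        where
        at-coordinate : ∀ i b → lookup (support ds) i ≡ b → lookup (settle ds Z Z) i ∧ᵇ not b ≡ lookup (settle ds Z Z) i
        at-coordinate i false eq = 𝔹.∧-identityʳ _
        at-coordinate i true  eq = trans (𝔹.∧-zeroʳ _) (sym (trans (settle-support ds sep Z Z i eq) (𝔹.xor-same (lookup Z i))))
      absorb : ∀ Z Y → settle ds (Z ⊕ (Y ∩ m)) (Z ⊕ (Y ∩ m)) ≡ (Y ⊕ settle ds Z Z) ∩ m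
      absorb Z Y = trans (settle-⊕ ds Z Z (Y ∩ m) λ i i∈ → trans (lookup-∩ Y m i)
          (trans (cong (lookup Y i ∧ᵇ_) (trans (lookup-∁ (support ds) i) (cong not i∈))) (𝔹.∧-zeroʳ _)))
        (trans (cong (_⊕ (Y ∩ m)) (sym (cleared Z)))
          (cube-id (v₀ :∩ v₁ :⊕ v₂ :∩ v₁) ((v₂ :⊕ v₀) :∩ v₁) (settle ds Z Z ∷ m ∷ Y ∷ [])))

  Dictators : ∀ {n} → BoolFun n → List (Block n) → Set
  Dictators f = All (λ B → Dictated (section f B))

  pivots : ∀ {n} (f : BoolFun n) {Bs} → Dictators f Bs → All Pivot Bs
  pivots f []                 = []
  pivots f (_∷_ {x = B} d ds) = (Dictated.τ d , relevant⇒cell f B (Dictated.τ d) (Dictated.relevant d)) ∷ pivots f ds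

  module _ {n} (f : BoolFun n) where

    -- Union bound over the blocks. If the checked side contains `τ`, the checks survive with
    -- probability at most `(1ℚ - δ) ^ s`; otherwise the answer was right and the flipped set
    -- follows `settle`.
    probed-dictated : ∀ s {Bs} (ds : Dictators f Bs) Z W {F} → (∀ W → 0ℚ ≤ F W) → (∀ W → F W ≤ 1ℚ) →
      probed f s Bs Z W F ≤ ι (length Bs) * (1ℚ - δ) ^ s + F (settle (pivots f ds) Z W)
    probed-dictated s [] Z W {F} 0≤F F≤1 = ≤-reflexive (step ((1ℚ - δ) ^ s) (F W))
      where
      step : ∀ e x → x ≡ 0ℚ * e + x
      step = solve-∀ ℚ-ring
    probed-dictated s (_∷_ {x = B} {xs = Bs} d ds) Z W {F} 0≤F F≤1 = by-side (lookup (side (hit h Z) Z) τ) refl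
      where
      h = section f B
      τ = Dictated.τ d
      e = (1ℚ - δ) ^ s
      W′ = settle (pivots f ds) Z (toggle (lookup Z τ) (cell B) W)
      0≤e : 0ℚ ≤ e
      0≤e = 0≤^ (nonNegative⁻¹ (1ℚ - δ)) s
      miss : ∀ b → lookup (side b Z) τ ≡ false → b ≡ lookup Z τ
      miss false eq = sym eq
      miss true  eq with lookup Z τ | trans (sym (lookup-∁ Z τ)) eq
      ... | true | _ = refl
      by-side : ∀ c → lookup (side (hit h Z) Z) τ ≡ c →
        blockRate h s Z * probed f s Bs Z (moved f B Z W) F ≤ (1ℚ + ι (length Bs)) * e + F W′
      by-side true eqc = ≤-trans (scale-≤ (0≤blockRate h s Z) (probed≤1 f s Bs Z (moved f B Z W) F≤1))
        (≤-trans (≤-reflexive (*-identityʳ (blockRate h s Z)))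
        (≤-trans (^-mono (0≤passRate h (side (hit h Z) Z)) (Dictated.rejects d (side (hit h Z) Z) eqc) s)
          (≤-by (0≤+ (0≤* (0≤ι (length Bs)) 0≤e) (0≤F W′)) (step e (ι (length Bs)) (F W′)))))
        where
        step : ∀ e l x → e + (l * e + x) ≡ ((1ℚ + l) * e + x) + 0ℚ
        step = solve-∀ ℚ-ring
      by-side false eqc = ≤-trans
        (*-monoʳ-≤-nonNeg (probed f s Bs Z (moved f B Z W) F)
          {{nonNegative (0≤probed f s Bs Z (moved f B Z W) 0≤F)}} (blockRate≤1 h s Z))
        (≤-trans (≤-reflexive (*-identityˡ (probed f s Bs Z (moved f B Z W) F)))
        (≤-trans (probed-dictated s ds Z (moved f B Z W) 0≤F F≤1)
          (≤-trans (≤-reflexive (cong (λ c → ι (length Bs) * e + F (settle (pivots f ds) Z (toggle c (cell B) W))) (miss (hit h Z) eqc)))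
            (≤-by 0≤e (step e (ι (length Bs)) (F W′))))))
        where
        step : ∀ e l x → (l * e + x) + e ≡ ((1ℚ + l) * e + x) + 0ℚ
        step = solve-∀ ℚ-ring

    -- `φ` generalises the accumulated set, which each block changes in a way that depends on `Z`.
    -- One block with mean rate at most `¾` settles the matter, all other factors being at most 1.
    classify : ∀ s → (1ℚ - δ) ^ suc s ≤ ¼ → ∀ {F} → (∀ W → 0ℚ ≤ F W) → (∀ W → F W ≤ 1ℚ) → ∀ Bs →
      (∀ (φ : Cube n → Cube n) → 𝔼 (cube n) (λ Z → probed f (suc s) Bs Z (φ Z) F) ≤ ¾) ⊎ Dictators f Bs
    classify s small 0≤F F≤1 [] = inj₂ []
    classify s small {F} 0≤F F≤1 (B ∷ Bs) = combine (Influence.blockRate-dichotomy h s small) (classify s small 0≤F F≤1 Bs)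
      where
      h = section f B
      combine : 𝔼 (cube n) (blockRate h (suc s)) ≤ ¾ ⊎ Dictated h →
        (∀ φ → 𝔼 (cube n) (λ Z → probed f (suc s) Bs Z (φ Z) F) ≤ ¾) ⊎ Dictators f Bs →
        (∀ φ → 𝔼 (cube n) (λ Z → blockRate h (suc s) Z * probed f (suc s) Bs Z (moved f B Z (φ Z)) F) ≤ ¾) ⊎ Dictators f (B ∷ Bs)
      combine (inj₁ le) _ = inj₁ λ φ → ≤-trans (mono (cube n) λ Z →
        ≤-trans (scale-≤ (0≤blockRate h (suc s) Z) (probed≤1 f (suc s) Bs Z (moved f B Z (φ Z)) F≤1))
          (≤-reflexive (*-identityʳ (blockRate h (suc s) Z)))) le
      combine (inj₂ d) (inj₁ le) = inj₁ λ φ → ≤-trans (mono (cube n) λ Z →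
        ≤-trans (*-monoʳ-≤-nonNeg (probed f (suc s) Bs Z (moved f B Z (φ Z)) F)
            {{nonNegative (0≤probed f (suc s) Bs Z (moved f B Z (φ Z)) 0≤F)}} (blockRate≤1 h (suc s) Z))
          (≤-reflexive (*-identityˡ (probed f (suc s) Bs Z (moved f B Z (φ Z)) F)))) (le (λ Z → moved f B Z (φ Z)))
      combine (inj₂ d) (inj₂ ds) = inj₂ (d ∷ ds)

  far-roundRate : ∀ {n k ε s} {f : BoolFun n} → Nonempty f → Far k ε f → ε ≤ 1ℚ →
    (1ℚ - δ) ^ suc s ≤ ¼ → ι k * (1ℚ - δ) ^ suc s ≤ ⅛ * ε →
    ∀ Bs → Valid k Bs → roundRate f (suc s) Bs ≤ 1ℚ - ⅛ * ε
  far-roundRate {n} {k} {ε} {s} {f} ne far ε≤1 small ke≤ Bs (len , sep) =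
    by-class (classify f s small (0≤stay ne) (stay≤1 ne) Bs)
    where
    e = (1ℚ - δ) ^ suc s
    0≤e : 0ℚ ≤ e
    0≤e = 0≤^ (nonNegative⁻¹ (1ℚ - δ)) (suc s)
    by-class : (∀ φ → 𝔼 (cube n) (λ Z → probed f (suc s) Bs Z (φ Z) (stay f)) ≤ ¾) ⊎ Dictators f Bs →
      roundRate f (suc s) Bs ≤ 1ℚ - ⅛ * ε
    by-class (inj₁ le) = ≤-trans (le (λ Z → Z)) (≤-trans (toWitness {a? = ¾ ≤? 1ℚ - ⅛ * 1ℚ} tt)
      (+-monoʳ-≤ 1ℚ (neg-antimono-≤ (scale-≤ (nonNegative⁻¹ ⅛) ε≤1))))
    by-class (inj₂ ds) = ≤-trans
      (𝔼-≤+ (cube n) {G = λ _ → ι (length Bs) * e} {H = λ Z → stay f (settle (pivots f ds) Z Z)} λ Z →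
        probed-dictated f (suc s) ds Z Z (0≤stay ne) (stay≤1 ne))
      (≤-trans (+-mono-≤ (≤-reflexive (𝔼-const (cube n) (ι (length Bs) * e))) (≤-reflexive (𝔼-settle (pivots f ds) sep (stay f))))
      -- Distance makes a flip missing the pivots leave f⁻¹(1) with probability at least ε/4; wrong
      -- answers take back at most ε/8.
      (≤-by (+-mono-≤ (≤-trans (*-monoʳ-≤-nonNeg e {{nonNegative 0≤e}} (ι-mono len)) ke≤)
          (scale-≤ (nonNegative⁻¹ ¼) (far-drift ne far (support (pivots f ds)) (ℕ.≤-trans (∣support∣≤ (pivots f ds)) len))))
        (step (ι (length Bs) * e) _ ε)))
      where
      step : ∀ l y ε → (l + y) + (⅛ * ε + ¼ * ((1ℚ + (1ℚ + (1ℚ + (1ℚ + 0ℚ)))) * (1ℚ - y))) ≡ (1ℚ - ⅛ * ε) + (l + ¼ * ε)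
      step = solve-∀ ℚ-ring

  -- Completeness

  mean-≤-on-ones : ∀ {n} {f : BoolFun n} → Nonempty f → ∀ {F G : Cube n → ℚ} →
    (∀ x → f x ≡ true → F x ≤ G x) → mean f F ≤ mean f G
  mean-≤-on-ones {n} {f} ne {F} {G} le = 0<⇒*-cancelˡ-≤ (0<density ne)
    (subst₂ _≤_ (sym (density-*-mean f F)) (sym (density-*-mean f G)) (mono (cube n) pointwise))
    where
    pointwise : ∀ x → 𝟙 (f x) * F x ≤ 𝟙 (f x) * G x
    pointwise x with f x in fx
    ... | true  = scale-≤ 0≤1 (le x fx)
    ... | false = ≤-reflexive (trans (*-zeroˡ (F x)) (sym (*-zeroˡ (G x))))

  DependsOn : ∀ {n} → Cube n → BoolFun n → Set
  DependsOn S f = ∀ x y → (∀ i → lookup S i ≡ true → lookup x i ≡ lookup y i) → f x ≡ f y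

  SameLabel : ∀ {n b} → Vec (Cube n) b → Fin n → Fin n → Set
  SameLabel []       i j = Data.Unit.⊤
  SameLabel (M ∷ Ms) i j = lookup M i ≡ lookup M j × SameLabel Ms i j

  Isolates : ∀ {n b} → Vec (Cube n) b → Cube n → Set
  Isolates Ms S = ∀ i j → lookup S i ≡ true → lookup S j ≡ true → SameLabel Ms i j → i ≡ j

  record Literal {n} (f : BoolFun n) (S : Cube n) (B : Block n) : Set where
    field
      τ      : Fin n
      τ∈S    : lookup S τ ≡ true
      τ∈cell : lookup (cell B) τ ≡ true
      unique : ∀ i → lookup S i ≡ true → lookup (cell B) i ≡ true → i ≡ τ
      value  : ∀ a → section f B a ≡ not (lookup a τ)

  module _ {n} (f : BoolFun n) where

    locate : ∀ {b} → Vec (Cube n) b → Cube n → Cube n → Cube n → Cube n × Cube n × Cube n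
    locate []       x w X = x , w , X
    locate (M ∷ Ms) x w X = if f (x ⊕ (w ∩ M))
      then locate Ms (x ⊕ (w ∩ M)) (w ∩ ∁ M) (X ∩ ∁ M) else locate Ms x (w ∩ M) (X ∩ M)

    located : Cube n × Cube n × Cube n → Block n
    located (x , _ , X) = block x X

    accProb-search : ∀ {b} (Ms : Vec (Cube n) b) x w X t →
      accProb f (search Ms x w X t) ≡ accProb f (t (located (locate Ms x w X)))
    accProb-search []       x w X t = refl
    accProb-search (M ∷ Ms) x w X t with f (x ⊕ (w ∩ M))
    ... | true  = accProb-search Ms _ _ _ t
    ... | false = accProb-search Ms _ _ _ t

    Sensitive : Cube n × Cube n × Cube n → Set
    Sensitive (x , w , X) = w ∩ X ≡ w × f x ≡ true × f (x ⊕ w) ≡ false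

    cell-of : Cube n × Cube n × Cube n → Cube n
    cell-of (_ , _ , X) = X

    ∩-≡-true : ∀ (x y : Cube n) i → lookup (x ∩ y) i ≡ true → lookup x i ≡ true × lookup y i ≡ true
    ∩-≡-true x y i eq with lookup x i | lookup y i | trans (sym (lookup-∩ x y i)) eq
    ... | true | true | _ = refl , refl

    ⊆-lookup : ∀ {x y : Cube n} {i} → x ∩ y ≡ x → lookup x i ≡ true → lookup y i ≡ true
    ⊆-lookup {x} {y} {i} sub eq = proj₂ (∩-≡-true x y i (trans (cong (λ z → lookup z i) sub) eq))

    locate-sensitive : ∀ {b} (Ms : Vec (Cube n) b) x w X → Sensitive (x , w , X) → Sensitive (locate Ms x w X)
    locate-sensitive []       x w X sens = sens
    locate-sensitive (M ∷ Ms) x w X (w⊆X , fx , fxw) with f (x ⊕ (w ∩ M)) in eq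
    ... | true  = locate-sensitive Ms _ _ _
      ( trans (cube-id (v₀ :∩ :∁ v₁ :∩ (v₂ :∩ :∁ v₁)) (v₀ :∩ v₂ :∩ :∁ v₁) (w ∷ M ∷ X ∷ [])) (cong (_∩ ∁ M) w⊆X)
      , eq
      , trans (cong f (cube-id (v₀ :⊕ v₁ :∩ v₂ :⊕ v₁ :∩ :∁ v₂) (v₀ :⊕ v₁) (x ∷ w ∷ M ∷ []))) fxw )
    ... | false = locate-sensitive Ms _ _ _
      ( trans (cube-id (v₀ :∩ v₁ :∩ (v₂ :∩ v₁)) (v₀ :∩ v₂ :∩ v₁) (w ∷ M ∷ X ∷ [])) (cong (_∩ M) w⊆X) , fx , eq )

    locate-⊆ : ∀ {b} (Ms : Vec (Cube n) b) x w X i → lookup (cell-of (locate Ms x w X)) i ≡ true → lookup X i ≡ true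
    locate-⊆ []       x w X i eq = eq
    locate-⊆ (M ∷ Ms) x w X i eq with f (x ⊕ (w ∩ M))
    ... | true  = proj₁ (∩-≡-true X (∁ M) i (locate-⊆ Ms _ _ _ i eq))
    ... | false = proj₁ (∩-≡-true X M i (locate-⊆ Ms _ _ _ i eq))

    locate-homogeneous : ∀ {b} (Ms : Vec (Cube n) b) x w X i j →
      lookup (cell-of (locate Ms x w X)) i ≡ true → lookup (cell-of (locate Ms x w X)) j ≡ true → SameLabel Ms i j
    locate-homogeneous []       x w X i j _  _  = tt
    locate-homogeneous (M ∷ Ms) x w X i j ei ej with f (x ⊕ (w ∩ M))
    ... | true  = 𝔹.not-injective (trans (sym (lookup-∁ M i)) (trans (bit i ei) (trans (sym (bit j ej)) (lookup-∁ M j))))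
                , locate-homogeneous Ms _ _ _ i j ei ej
      where
      bit : ∀ i → lookup (cell-of (locate Ms (x ⊕ (w ∩ M)) (w ∩ ∁ M) (X ∩ ∁ M))) i ≡ true → lookup (∁ M) i ≡ true
      bit i ei = proj₂ (∩-≡-true X (∁ M) i (locate-⊆ Ms _ _ _ i ei))
    ... | false = trans (bit i ei) (sym (bit j ej)) , locate-homogeneous Ms _ _ _ i j ei ej
      where
      bit : ∀ i → lookup (cell-of (locate Ms x (w ∩ M) (X ∩ M))) i ≡ true → lookup M i ≡ true
      bit i ei = proj₂ (∩-≡-true X M i (locate-⊆ Ms _ _ _ i ei))

    false≢true : false ≢ true
    false≢true ()

    -- `w` meets `S`, else flipping it could not change `f`. The meeting point `τ` is the only
    -- variable of `S` in `X`, so on `S` the set `a ∩ X` agrees with `w` or with `∅`, according to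
    -- whether `a` contains `τ`.
    sensitive⇒literal : ∀ {S x w X} → DependsOn S f → Sensitive (x , w , X) →
      (∀ i j → lookup S i ≡ true → lookup S j ≡ true → lookup X i ≡ true → lookup X j ≡ true → i ≡ j) →
      Literal f S (block x X)
    sensitive⇒literal {S} {x} {w} {X} dep (w⊆X , fx , fxw) single = conclude
      (Fin.any? λ i → (lookup S i 𝔹.≟ true) ×-dec (lookup w i 𝔹.≟ true))
      where
      agree : ∀ {y z} → (∀ i → lookup S i ≡ true → lookup y i ≡ lookup z i) → ∀ i → lookup S i ≡ true → lookup (x ⊕ y) i ≡ lookup (x ⊕ z) i
      agree {y} {z} eq i i∈ = trans (lookup-⊕ x y i) (trans (cong (lookup x i xor_) (eq i i∈)) (sym (lookup-⊕ x z i)))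
      conclude : Dec (∃[ i ] lookup S i ≡ true × lookup w i ≡ true) → Literal f S (block x X)
      conclude (no none) = ⊥-elim (false≢true (trans (sym fxw) (trans (dep (x ⊕ w) (x ⊕ ∅) (agree λ i i∈ →
        trans (𝔹.¬-not λ wi → none (i , i∈ , wi)) (sym (Vec.lookup-replicate i false))))
        (trans (cong f (cube-id (v₀ :⊕ :∅) v₀ (x ∷ []))) fx))))
      conclude (yes (τ , τ∈S , wτ)) = record
        { τ      = τ
        ; τ∈S    = τ∈S
        ; τ∈cell = ⊆-lookup w⊆X wτ
        ; unique = λ i i∈S i∈X → single i τ i∈S τ∈S i∈X (⊆-lookup w⊆X wτ)
        ; value  = λ a → by-bit a (lookup a τ) refl
        }
        where
        by-bit : ∀ a b → lookup a τ ≡ b → f (x ⊕ (a ∩ X)) ≡ not b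
        by-bit a true aτ = trans (dep _ _ (agree λ i i∈ → trans (lookup-∩ a X i) (coordinate i i∈ (lookup X i) refl))) fxw
          where
          coordinate : ∀ i → lookup S i ≡ true → ∀ c → lookup X i ≡ c → lookup a i ∧ᵇ c ≡ lookup w i
          coordinate i i∈ true  i∈X with single i τ i∈ τ∈S i∈X (⊆-lookup w⊆X wτ)
          ... | refl = trans (cong (_∧ᵇ true) aτ) (sym wτ)
          coordinate i i∈ false i∉X = trans (𝔹.∧-zeroʳ (lookup a i))
            (sym (𝔹.¬-not λ wi → false≢true (trans (sym i∉X) (⊆-lookup w⊆X wi))))
        by-bit a false aτ = trans (dep _ (x ⊕ ∅) (agree λ i i∈ → trans (lookup-∩ a X i)
            (trans (coordinate i i∈ (lookup X i) refl) (sym (Vec.lookup-replicate i false)))))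
          (trans (cong f (cube-id (v₀ :⊕ :∅) v₀ (x ∷ []))) fx)
          where
          coordinate : ∀ i → lookup S i ≡ true → ∀ c → lookup X i ≡ c → lookup a i ∧ᵇ c ≡ false
          coordinate i i∈ true  i∈X with single i τ i∈ τ∈S i∈X (⊆-lookup w⊆X wτ)
          ... | refl = cong (_∧ᵇ true) aτ
          coordinate i i∈ false i∉X = 𝔹.∧-zeroʳ (lookup a i)

    Literals : Cube n → List (Block n) → Set
    Literals S = All (Literal f S)

    literal-pivots : ∀ {S Bs} → Literals S Bs → All Pivot Bs
    literal-pivots []       = []
    literal-pivots (l ∷ ls) = (Literal.τ l , Literal.τ∈cell l) ∷ literal-pivots ls

    literal-hit : ∀ {S B} (l : Literal f S B) Z → hit (section f B) Z ≡ lookup Z (Literal.τ l)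
    literal-hit l Z = trans (cong₂ _xor_ (trans (value ∅) (cong not (Vec.lookup-replicate τ false))) (value Z))
      (𝔹.not-involutive _)
      where open Literal l

    -- A literal answers correctly, so the checked side misses `τ` and no check can fail.
    literal-blockRate : ∀ {S B} (l : Literal f S B) s Z → blockRate (section f B) s Z ≡ 1ℚ
    literal-blockRate {B = B} l s Z = trans (cong (_^ s) (trans
      (𝔼-cong (cube n) λ a → trans (𝔼-cong (cube n) λ r → cong 𝟙 (steady-true a r)) (normalised (cube n)))
      (normalised (cube n)))) (1^ s)
      where
      open Literal l
      h = section f B
      O = side (hit h Z) Z
      Oτ : lookup O τ ≡ false
      Oτ = trans (cong (λ d → lookup (side d Z) τ) (literal-hit l Z)) (missed (lookup Z τ) refl)
        where
        missed : ∀ b → lookup Z τ ≡ b → lookup (side b Z) τ ≡ false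
        missed false eq = eq
        missed true  eq = trans (lookup-∁ Z τ) (cong not eq)
      steady-true : ∀ a r → steady h O a r ≡ true
      steady-true a r = trans (cong₂ (λ p q → not (h a xor p) ∧ᵇ (h a xor q)) unchanged flipped) (bits (h a))
        where
        unchanged : h (a ⊕ (r ∩ O)) ≡ h a
        unchanged = trans (value _) (trans (cong not (trans (lookup-⊕ a (r ∩ O) τ)
          (trans (cong (lookup a τ xor_) (trans (lookup-∩ r O τ) (trans (cong (lookup r τ ∧ᵇ_) Oτ) (𝔹.∧-zeroʳ _)))) (𝔹.xor-identityʳ _))))
          (sym (value a)))
        flipped : h (∁ a) ≡ not (h a)
        flipped = trans (value (∁ a)) (cong not (trans (lookup-∁ a τ) (sym (value a))))
        bits : ∀ b → not (b xor b) ∧ᵇ (b xor not b) ≡ true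
        bits false = refl
        bits true  = refl

    literals-probed : ∀ {S Bs} (ls : Literals S Bs) s Z W F →
      probed f s Bs Z W F ≡ F (settle (literal-pivots ls) Z W)
    literals-probed []                    s Z W F = refl
    literals-probed (_∷_ {x = B} {xs = Bs} l ls) s Z W F = trans
      (cong (_* probed f s Bs Z (moved f B Z W) F) (literal-blockRate l s Z))
      (trans (*-identityˡ (probed f s Bs Z (moved f B Z W) F))
      (trans (literals-probed ls s Z (moved f B Z W) F)
        (cong (λ d → F (settle (literal-pivots ls) Z (toggle d (cell B) W))) (literal-hit l Z))))

    ¬free⇒support : ∀ {S Bs} (ls : Literals S Bs) i → lookup S i ≡ true → lookup (free Bs) i ≡ false →
      lookup (support (literal-pivots ls)) i ≡ true
    ¬free⇒support [] i i∈ eq = ⊥-elim (false≢true (trans (sym eq) (Vec.lookup-replicate i true)))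
    ¬free⇒support (_∷_ {x = B} {xs = Bs} l ls) i i∈ eq = trans (lookup-∪ ⁅ τ ⁆ (support (literal-pivots ls)) i)
      (by-cell (lookup (cell B) i) refl)
      where
      open Literal l
      by-cell : ∀ c → lookup (cell B) i ≡ c → lookup ⁅ τ ⁆ i ∨ᵇ lookup (support (literal-pivots ls)) i ≡ true
      by-cell true  i∈B with unique i i∈ i∈B
      ... | refl = cong (_∨ᵇ lookup (support (literal-pivots ls)) τ) (singleton-lookup τ)
      by-cell false i∉B = trans (cong (lookup ⁅ τ ⁆ i ∨ᵇ_) (¬free⇒support ls i i∈
        (trans (sym (𝔹.∧-identityʳ _)) (trans (sym (trans (lookup-free B Bs i) (cong (λ c → lookup (free Bs) i ∧ᵇ not c) i∉B))) eq))))
        (𝔹.∨-zeroʳ _)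

    -- The variables of `S` outside `free Bs` are all pivots, and these are cleared; inside
    -- `free Bs` nothing is toggled.
    settle-on-S : ∀ {S Bs} (ls : Literals S Bs) → Separated Bs → ∀ Z i → lookup S i ≡ true →
      lookup (settle (literal-pivots ls) Z Z) i ≡ lookup (Z ∩ free Bs) i
    settle-on-S {Bs = Bs} ls sep Z i i∈ = trans (by-free (lookup (free Bs) i) refl) (sym (lookup-∩ Z (free Bs) i))
      where
      by-free : ∀ c → lookup (free Bs) i ≡ c → lookup (settle (literal-pivots ls) Z Z) i ≡ lookup Z i ∧ᵇ c
      by-free true  fr = trans (settle-free (literal-pivots ls) Z Z i fr) (sym (𝔹.∧-identityʳ _))
      by-free false fr = trans (settle-support (literal-pivots ls) sep Z Z i (¬free⇒support ls i i∈ fr))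
        (trans (𝔹.xor-same (lookup Z i)) (sym (𝔹.∧-zeroʳ _)))

    literals-roundRate : ∀ {S Bs} → Nonempty f → DependsOn S f → Literals S Bs → Separated Bs → ∀ s →
      roundRate f s Bs ≡ 1ℚ - drift f (free Bs)
    literals-roundRate {S} {Bs} ne dep ls sep s = trans
      (𝔼-cong (cube n) λ Z → trans (literals-probed ls s Z Z (stay f)) (𝔼-cong (sampleᴱ ne) λ x →
        cong 𝟙 (dep (x ⊕ settle (literal-pivots ls) Z Z) (x ⊕ (Z ∩ free Bs)) λ i i∈ →
          trans (lookup-⊕ x _ i) (trans (cong (lookup x i xor_) (settle-on-S ls sep Z i i∈)) (sym (lookup-⊕ x _ i))))))
      (step (𝔼 (cube n) λ Z → stay f (Z ∩ free Bs)))
      where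
      step : ∀ a → a ≡ 1ℚ - (1ℚ - a)
      step = solve-∀ ℚ-ring

    drift-⊆ : Nonempty f → ∀ m m′ → m ∩ m′ ≡ m → drift f m ≤ drift f m′ + drift f m′
    drift-⊆ ne m m′ sub = 0<⇒*-cancelˡ-≤ {c = density f + density f} (+-mono-< (0<density ne) (0<density ne))
      (≤-trans (≤-reflexive (sym (influence-drift ne m))) (≤-trans (Influence.influence-⊆ f m m′ sub)
      (≤-reflexive (trans (cong₂ _+_ (influence-drift ne m′) (influence-drift ne m′))
        (sym (*-distribˡ-+ (density f + density f) (drift f m′) (drift f m′)))))))

    module Explore (ne : Nonempty f) {S : Cube n} (dep : DependsOn S f) {k : ℕ} (s m : ℕ)
                   {b} (Ms : Vec (Cube n) b) (iso : Isolates Ms S) where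

      remaining : List (Block n) → ℕ
      remaining Bs = ∣ S ∩ free Bs ∣

      -- Each new block uses up at least one relevant variable still free; counting these together
      -- with the blocks keeps the list within length `k`.
      Sound : List (Block n) → Set
      Sound Bs = Literals S Bs × Separated Bs × length Bs ℕ.+ remaining Bs ℕ.≤ k

      extend : ∀ Bs x w → Sound Bs → f x ≡ true → f (x ⊕ (w ∩ free Bs)) ≡ false →
        let B = located (locate Ms x (w ∩ free Bs) (free Bs)) in
        Sound (B ∷ Bs) × remaining (B ∷ Bs) ℕ.< remaining Bs
      extend Bs x w (ls , sep , len) fx fxw = (lit ∷ ls , (cell⊆ , sep) , len′) , fewer
        where
        w′ = w ∩ free Bs
        L  = locate Ms x w′ (free Bs)
        B  = located L
        sens : Sensitive L
        sens = locate-sensitive Ms x w′ (free Bs)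
          (cube-id (v₀ :∩ v₁ :∩ v₁) (v₀ :∩ v₁) (w ∷ free Bs ∷ []) , fx , fxw)
        lit : Literal f S B
        lit = sensitive⇒literal dep sens λ i j i∈S j∈S i∈X j∈X →
          iso i j i∈S j∈S (locate-homogeneous Ms x w′ (free Bs) i j i∈X j∈X)
        open Literal lit
        within : ∀ i → lookup (cell B) i ≡ true → lookup (free Bs) i ≡ true
        within = locate-⊆ Ms x w′ (free Bs)
        cell⊆ : cell B ∩ free Bs ≡ cell B
        cell⊆ = lookup-ext λ i → trans (lookup-∩ (cell B) (free Bs) i) (absorbed i (lookup (cell B) i) refl)
          where
          absorbed : ∀ i c → lookup (cell B) i ≡ c → c ∧ᵇ lookup (free Bs) i ≡ c
          absorbed i false _  = refl
          absorbed i true  eq = within i eq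
        fewer : remaining (B ∷ Bs) ℕ.< remaining Bs
        fewer = Subset.p⊂q⇒∣p∣<∣q∣ (included , τ , lookup⇒∈ in-old , λ τ∈ → excluded (∈⇒lookup τ∈))
          where
          included : ∀ {i} → i ∈ₛ (S ∩ (free Bs ∩ ∁ (cell B))) → i ∈ₛ (S ∩ free Bs)
          included {i} i∈ = let i∈S , i∈fr = ∩-≡-true S (free Bs ∩ ∁ (cell B)) i (∈⇒lookup i∈)
                                i∈fr′ , _ = ∩-≡-true (free Bs) (∁ (cell B)) i i∈fr
                            in lookup⇒∈ (trans (lookup-∩ S (free Bs) i) (cong₂ _∧ᵇ_ i∈S i∈fr′))
          in-old : lookup (S ∩ free Bs) τ ≡ true
          in-old = trans (lookup-∩ S (free Bs) τ) (cong₂ _∧ᵇ_ τ∈S (within τ τ∈cell))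
          excluded : lookup (S ∩ (free Bs ∩ ∁ (cell B))) τ ≢ true
          excluded eq = let _ , e = ∩-≡-true S (free Bs ∩ ∁ (cell B)) τ eq
                            _ , e′ = ∩-≡-true (free Bs) (∁ (cell B)) τ e
                        in false≢true (trans (cong not (sym τ∈cell)) (trans (sym (lookup-∁ (cell B) τ)) e′))
        len′ : suc (length Bs) ℕ.+ remaining (B ∷ Bs) ℕ.≤ k
        len′ = ℕ.≤-trans (ℕ.≤-reflexive (sym (ℕ.+-suc (length Bs) (remaining (B ∷ Bs)))))
          (ℕ.≤-trans (ℕ.+-monoʳ-≤ (length Bs) fewer) len)

      acceptance : ℕ → List (Block n) → ℚ
      acceptance r Bs = accProb f (explore Ms r Bs (verify k s m))

      verified : ∀ Bs → Sound Bs → 1ℚ - ι m * drift f (free Bs) ≤ acceptance 0 Bs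
      verified Bs (ls , sep , len) = outcome (valid? k Bs)
        where
        rate : roundRate f s Bs ≡ 1ℚ - drift f (free Bs)
        rate = literals-roundRate ne dep ls sep s
        step : ∀ d → 1ℚ - (1ℚ - d) ≡ d
        step = solve-∀ ℚ-ring
        outcome : (d : Dec (Valid k Bs)) →
          1ℚ - ι m * drift f (free Bs) ≤ accProb f (if does d then verifyRounds s m Bs else halt false)
        outcome (yes _) = ≤-trans
          (≤-reflexive (cong (λ d → 1ℚ - ι m * d) (sym (trans (cong (λ p → 1ℚ - p) rate) (step (drift f (free Bs)))))))
          (≤-trans (bernoulli-lower (0≤roundRate ne s Bs) (roundRate≤1 ne s Bs) m)
            (≤-reflexive (sym (accProb-verifyRounds ne s m Bs))))
        outcome (no ¬v) = contradiction (ℕ.≤-trans (ℕ.m≤m+n (length Bs) (remaining Bs)) len , sep) ¬v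

      branch : ℕ → List (Block n) → Cube n → Cube n → ℚ
      branch r Bs x w = accProb f (if f (x ⊕ (w ∩ free Bs)) then explore Ms r Bs (verify k s m)
        else search Ms x (w ∩ free Bs) (free Bs) λ B → explore Ms r (B ∷ Bs) (verify k s m))

      acceptance-suc : ∀ r Bs → acceptance (suc r) Bs ≡ mean f (λ x → 𝔼 (cube n) (branch r Bs x))
      acceptance-suc r Bs = 𝔼-cong (sampleᴱ ne) λ x → accProb-randomCube f n _

      -- The motive also sees the answer to the query, since a step that finds a block is credited
      -- differently from one that does not.
      branch-cases : ∀ r Bs x w (P : Bool → ℚ → Set) → f x ≡ true → Sound Bs →
        P true (acceptance r Bs) →
        (∀ B → Sound (B ∷ Bs) → remaining (B ∷ Bs) ℕ.< remaining Bs → P false (acceptance r (B ∷ Bs))) →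
        P (f (x ⊕ (w ∩ free Bs))) (branch r Bs x w)
      branch-cases r Bs x w P fx sound pass found with f (x ⊕ (w ∩ free Bs)) in eq
      ... | true  = pass
      ... | false = let sound′ , fewer = extend Bs x w sound fx eq in
        subst (P false) (sym (accProb-search Ms x (w ∩ free Bs) (free Bs) (λ B → explore Ms r (B ∷ Bs) (verify k s m))))
          (found _ sound′ fewer)

      -- Free sets only shrink. Comparing with a fixed earlier `m₀` at the very end pays the factor
      -- 2 of monotonicity once instead of once per step.
      acceptance-≥-drift : ∀ r Bs m₀ → free Bs ∩ m₀ ≡ free Bs → Sound Bs →
        1ℚ - ι m * (drift f m₀ + drift f m₀) ≤ acceptance r Bs
      acceptance-≥-drift zero Bs m₀ sub sound = ≤-trans
        (+-monoʳ-≤ 1ℚ (neg-antimono-≤ (scale-≤ (0≤ι m) (drift-⊆ ne (free Bs) m₀ sub)))) (verified Bs sound)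
      acceptance-≥-drift (suc r) Bs m₀ sub sound = ≤-trans
        (𝔼-≥ (sampleᴱ ne) λ _ → ≤-refl)
        (≤-trans (mean-≤-on-ones ne {F = λ _ → c} λ x fx → 𝔼-≥ (cube n) λ w →
          branch-cases r Bs x w (λ _ p → c ≤ p) fx sound (acceptance-≥-drift r Bs m₀ sub sound) λ B sound′ _ →
            acceptance-≥-drift r (B ∷ Bs) m₀ (shrink B) sound′)
        (≤-reflexive (sym (acceptance-suc r Bs))))
        where
        c = 1ℚ - ι m * (drift f m₀ + drift f m₀)
        shrink : ∀ B → free (B ∷ Bs) ∩ m₀ ≡ free (B ∷ Bs)
        shrink B = trans (cube-id (v₀ :∩ :∁ v₁ :∩ v₂) (v₀ :∩ v₂ :∩ :∁ v₁) (free Bs ∷ cell B ∷ m₀ ∷ [])) (cong (_∩ ∁ (cell B)) sub)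

      -- Each successful exploration lowers the number of remaining variables, and the drift at the end is
      -- at most twice the drift at any earlier stage; so after r steps it is at most 2k/r on average.
      acceptance-≥-remaining : ∀ r Bs → Sound Bs →
        ι r - (ι m + ι m) * ι (remaining Bs) ≤ ι r * acceptance r Bs
      acceptance-≥-remaining zero Bs sound = ≤-by (0≤* (0≤+ (0≤ι m) (0≤ι m)) (0≤ι (remaining Bs)))
        (step (ι m + ι m) (ι (remaining Bs)) (acceptance 0 Bs))
        where
        step : ∀ a b c → (0ℚ - a * b) + a * b ≡ 0ℚ * c + 0ℚ
        step = solve-∀ ℚ-ring
      -- Of the `1 + r` copies of the acceptance, `r` earn an expected credit of `M` times the
      -- drift, which cancels the loss in the remaining one.
      acceptance-≥-remaining (suc r) Bs sound = ≤-by
        (+-mono-≤ main (acceptance-≥-drift (suc r) Bs (free Bs) (cube-id (v₀ :∩ v₀) v₀ (free Bs ∷ [])) sound))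
        (step (ι r) (ι m) (ι (remaining Bs)) (drift f (free Bs)) (acceptance (suc r) Bs))
        where
        M = ι m + ι m
        step : ∀ r m R d A → ((1ℚ + r) - (m + m) * R) + (r * A + A)
             ≡ (1ℚ + r) * A + ((r - (m + m) * R + (m + m) * d) + (1ℚ - m * (d + d)))
        step = solve-∀ ℚ-ring
        joint : Expectation (Cube n × Cube n)
        joint = sampleᴱ ne ⊗ cube n via _,_
        leaves : Cube n × Cube n → ℚ
        leaves (x , w) = 1ℚ - 𝟙 (f (x ⊕ (w ∩ free Bs)))
        c : Bool → ℚ
        c p = (ι r - M * ι (remaining Bs)) + M * (1ℚ - 𝟙 p)
        leaves-drift : 𝔼 joint leaves ≡ drift f (free Bs)
        leaves-drift = trans (𝔼-complement joint _) (cong (λ p → 1ℚ - p) (𝔼-swap (sampleᴱ ne) n _))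
        found : ∀ B → Sound (B ∷ Bs) → remaining (B ∷ Bs) ℕ.< remaining Bs → c false ≤ ι r * acceptance r (B ∷ Bs)
        found B sound′ fewer = ≤-trans (≤-by (scale-≤ (0≤+ (0≤ι m) (0≤ι m)) (ι-mono fewer))
            (one (ι r) M (ι (remaining Bs)) (ι (remaining (B ∷ Bs)))))
          (acceptance-≥-remaining r (B ∷ Bs) sound′)
          where
          one : ∀ r M R R′ → ((r - M * R) + M * (1ℚ - 0ℚ)) + M * R ≡ (r - M * R′) + M * (1ℚ + R′)
          one = solve-∀ ℚ-ring
        pass : c true ≤ ι r * acceptance r Bs
        pass = ≤-trans (≤-reflexive (zero-gain (ι r - M * ι (remaining Bs)) M)) (acceptance-≥-remaining r Bs sound)
          where
          zero-gain : ∀ a M → a + M * (1ℚ - 1ℚ) ≡ a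
          zero-gain = solve-∀ ℚ-ring
        main : (ι r - M * ι (remaining Bs)) + M * drift f (free Bs) ≤ ι r * acceptance (suc r) Bs
        main = ≤-trans (≤-reflexive (sym (trans (additive joint (λ _ → ι r - M * ι (remaining Bs)) (λ xw → M * leaves xw))
            (cong₂ _+_ (𝔼-const joint (ι r - M * ι (remaining Bs)))
              (trans (homogeneous joint M leaves) (cong (M *_) leaves-drift))))))
          (≤-trans (mean-≤-on-ones ne λ x fx → mono (cube n) {G = λ w → ι r * branch r Bs x w} λ w →
            branch-cases r Bs x w (λ p q → c p ≤ ι r * q) fx sound pass found)
          (≤-reflexive (trans (homogeneous joint (ι r) (λ (x , w) → branch r Bs x w)) (cong (ι r *_) (sym (acceptance-suc r Bs))))))

  -- Random labels separate the relevant variables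

  sum-on : ∀ {n} → Cube n → (Fin n → ℚ) → ℚ
  sum-on []      G = 0ℚ
  sum-on (b ∷ S) G = 𝟙 b * G zero + sum-on S (G ∘ suc)

  sum-on-const : ∀ {n} (S : Cube n) c → sum-on S (λ _ → c) ≡ ι ∣ S ∣ * c
  sum-on-const []          c = sym (*-zeroˡ c)
  sum-on-const (true ∷ S)  c = trans (cong (1ℚ * c +_) (sum-on-const S c)) (step (ι ∣ S ∣) c)
    where
    step : ∀ a c → 1ℚ * c + a * c ≡ (1ℚ + a) * c
    step = solve-∀ ℚ-ring
  sum-on-const (false ∷ S) c = trans (cong₂ _+_ (*-zeroˡ c) (sum-on-const S c)) (+-identityˡ _)

  sum-on-mono : ∀ {n} (S : Cube n) {G H} → (∀ i → G i ≤ H i) → sum-on S G ≤ sum-on S H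
  sum-on-mono []      le = ≤-refl
  sum-on-mono (b ∷ S) le = +-mono-≤ (scale-≤ (0≤𝟙 b) (le zero)) (sum-on-mono S (le ∘ suc))

  0≤sum-on : ∀ {n} (S : Cube n) {G} → (∀ i → 0ℚ ≤ G i) → 0ℚ ≤ sum-on S G
  0≤sum-on []      0≤G = ≤-refl
  0≤sum-on (b ∷ S) 0≤G = 0≤+ (0≤* (0≤𝟙 b) (0≤G zero)) (0≤sum-on S (0≤G ∘ suc))

  term≤sum-on : ∀ {n} (S : Cube n) {G} → (∀ i → 0ℚ ≤ G i) → ∀ i → lookup S i ≡ true → G i ≤ sum-on S G
  term≤sum-on (true ∷ S) {G} 0≤G zero refl = ≤-by (0≤sum-on S (0≤G ∘ suc)) (step (G zero) (sum-on S (G ∘ suc)))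
    where
    step : ∀ a b → a + b ≡ (1ℚ * a + b) + 0ℚ
    step = solve-∀ ℚ-ring
  term≤sum-on (b ∷ S) {G} 0≤G (suc i) i∈ = ≤-by (+-mono-≤ (0≤* (0≤𝟙 b) (0≤G zero)) (term≤sum-on S (0≤G ∘ suc) i i∈))
    (step (𝟙 b * G zero) (G (suc i)) (sum-on S (G ∘ suc)))
    where
    step : ∀ a b c → b + (a + c) ≡ (a + c) + (0ℚ + b)
    step = solve-∀ ℚ-ring

  𝔼-sum-on : ∀ {X : Set} (ex : Expectation X) {n} (S : Cube n) (G : Fin n → X → ℚ) →
    𝔼 ex (λ x → sum-on S (λ i → G i x)) ≡ sum-on S (λ i → 𝔼 ex (G i))
  𝔼-sum-on ex []      G = 𝔼-const ex 0ℚ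
  𝔼-sum-on ex (b ∷ S) G = trans (additive ex _ _)
    (cong₂ _+_ (homogeneous ex (𝟙 b) (G zero)) (𝔼-sum-on ex S (G ∘ suc)))

  sameᵇ : ∀ {n b} → Vec (Cube n) b → Fin n → Fin n → Bool
  sameᵇ []       i j = true
  sameᵇ (M ∷ Ms) i j = not (lookup M i xor lookup M j) ∧ᵇ sameᵇ Ms i j

  sameLabel⇒sameᵇ : ∀ {n b} (Ms : Vec (Cube n) b) i j → SameLabel Ms i j → sameᵇ Ms i j ≡ true
  sameLabel⇒sameᵇ []       i j _         = refl
  sameLabel⇒sameᵇ (M ∷ Ms) i j (eq , sl) = cong₂ _∧ᵇ_
    (cong not (trans (cong (_xor lookup M j) eq) (𝔹.xor-same (lookup M j)))) (sameLabel⇒sameᵇ Ms i j sl)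

  𝟙-∧ : ∀ a b → 𝟙 (a ∧ᵇ b) ≡ 𝟙 a * 𝟙 b
  𝟙-∧ false b = sym (*-zeroˡ (𝟙 b))
  𝟙-∧ true  b = sym (*-identityˡ (𝟙 b))

  -- Flipping coordinate j is measure preserving and exchanges the event with its complement.
  𝔼-same-bit : ∀ {n} (i j : Fin n) → i ≢ j → 𝔼 (cube n) (λ M → 𝟙 (not (lookup M i xor lookup M j))) ≡ ½
  𝔼-same-bit {n} i j i≢j = half (trans (sym (𝔼-shift n ⁅ j ⁆ (λ M → 𝟙 (same M))))
    (trans (𝔼-cong (cube n) λ M → trans (cong 𝟙 (flipped M)) (𝟙-not (same M))) (𝔼-complement (cube n) (λ M → 𝟙 (same M)))))
    where
    same : Cube n → Bool
    same M = not (lookup M i xor lookup M j)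
    flipped : ∀ M → same (M ⊕ ⁅ j ⁆) ≡ not (same M)
    flipped M = trans (cong₂ (λ p q → not (p xor q))
      (trans (lookup-⊕ M ⁅ j ⁆ i) (cong (lookup M i xor_) (singleton-lookup-≢ (i≢j ∘ sym))))
      (trans (lookup-⊕ M ⁅ j ⁆ j) (cong (lookup M j xor_) (singleton-lookup j))))
      (bits (lookup M i) (lookup M j))
      where
      bits : ∀ p q → not ((p xor false) xor (q xor true)) ≡ not (not (p xor q))
      bits false false = refl
      bits false true  = refl
      bits true  false = refl
      bits true  true  = refl
    half : ∀ {x} → x ≡ 1ℚ - x → x ≡ ½
    half {x} eq = 0<⇒*-cancelˡ {c = 1ℚ + 1ℚ} (positive⁻¹ (1ℚ + 1ℚ)) (trans (double x) (trans (cong (x +_) eq) (cancel x)))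
      where
      double : ∀ x → (1ℚ + 1ℚ) * x ≡ x + x
      double = solve-∀ ℚ-ring
      cancel : ∀ x → x + (1ℚ - x) ≡ 1ℚ
      cancel = solve-∀ ℚ-ring

  𝔼-same : ∀ {n} b (i j : Fin n) → i ≢ j → 𝔼 (vecᴱ (cube n) b) (λ Ms → 𝟙 (sameᵇ Ms i j)) ≡ ½ ^ b
  𝔼-same         zero    i j i≢j = refl
  𝔼-same {n = n} (suc b) i j i≢j = trans
    (𝔼-cong (cube n) λ M → trans (𝔼-cong (vecᴱ (cube n) b) λ Ms → 𝟙-∧ (not (lookup M i xor lookup M j)) (sameᵇ Ms i j))
      (trans (homogeneous (vecᴱ (cube n) b) (𝟙 (not (lookup M i xor lookup M j))) (λ Ms → 𝟙 (sameᵇ Ms i j)))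
        (cong (𝟙 (not (lookup M i xor lookup M j)) *_) (𝔼-same b i j i≢j))))
    (trans (𝔼-*ʳ (cube n) (λ M → 𝟙 (not (lookup M i xor lookup M j))) (½ ^ b)) (cong (_* ½ ^ b) (𝔼-same-bit i j i≢j)))

  clash : ∀ {n b} (i j : Fin n) → Vec (Cube n) b → Bool
  clash i j Ms = not (does (i Fin.≟ j)) ∧ᵇ sameᵇ Ms i j

  collisions : ∀ {n b} → Cube n → Vec (Cube n) b → ℚ
  collisions S Ms = sum-on S λ i → sum-on S λ j → 𝟙 (clash i j Ms)

  0≤collisions : ∀ {n b} (S : Cube n) (Ms : Vec (Cube n) b) → 0ℚ ≤ collisions S Ms
  0≤collisions S Ms = 0≤sum-on S λ i → 0≤sum-on S λ j → 0≤𝟙 (clash i j Ms)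

  𝔼-clash : ∀ {n} b (i j : Fin n) → 𝔼 (vecᴱ (cube n) b) (λ Ms → 𝟙 (clash i j Ms)) ≤ ½ ^ b
  𝔼-clash {n} b i j with i Fin.≟ j
  ... | yes _  = ≤-trans (≤-reflexive (𝔼-const (vecᴱ (cube n) b) 0ℚ)) (0≤^ 0≤½ b)
  ... | no i≢j = ≤-reflexive (𝔼-same b i j i≢j)

  𝔼-collisions : ∀ {n} b (S : Cube n) → 𝔼 (vecᴱ (cube n) b) (collisions S) ≤ ι ∣ S ∣ * (ι ∣ S ∣ * ½ ^ b)
  𝔼-collisions {n} b S = ≤-trans (≤-reflexive (𝔼-sum-on vs S (λ i Ms → sum-on S λ j → 𝟙 (clash i j Ms))))
    (≤-trans (sum-on-mono S λ i → ≤-trans (≤-reflexive (𝔼-sum-on vs S (λ j Ms → 𝟙 (clash i j Ms))))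
      (≤-trans (sum-on-mono S λ j → 𝔼-clash b i j) (≤-reflexive (sum-on-const S (½ ^ b)))))
    (≤-reflexive (sum-on-const S (ι ∣ S ∣ * ½ ^ b))))
    where
    vs = vecᴱ (cube n) b

  few-collisions⇒isolates : ∀ {n b} (S : Cube n) (Ms : Vec (Cube n) b) → collisions S Ms < 1ℚ → Isolates Ms S
  few-collisions⇒isolates S Ms lt i j i∈ j∈ sl = by-dec (i Fin.≟ j) ≤-refl
    where
    by-dec : (d : Dec (i ≡ j)) → 𝟙 (not (does d) ∧ᵇ sameᵇ Ms i j) ≤ 𝟙 (clash i j Ms) → i ≡ j
    by-dec (yes eq) _  = eq
    by-dec (no _)   le = ⊥-elim (<-irrefl refl (≤-<-trans (≤-trans
      (≤-reflexive (cong 𝟙 (sym (sameLabel⇒sameᵇ Ms i j sl)))) (≤-trans le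
      (≤-trans (term≤sum-on S (λ j → 0≤𝟙 (clash i j Ms)) j j∈)
        (term≤sum-on S (λ i → 0≤sum-on S λ j → 0≤𝟙 (clash i j Ms)) i i∈)))) lt))

  ⅙ : ℚ
  ⅙ = ℤ.+ 1 / 6

  -- For every labelling the acceptance is at least `⅚` minus the collisions: without collisions by
  -- the exploration bound, otherwise because the difference is not positive. Averaging this needs
  -- no conditioning on good labels.
  completeness : ∀ {n k b r s m} {f : BoolFun n} → Nonempty f → IsJunta k f →
    0ℚ < ι r → (ι m + ι m) * ι k ≤ ι r * ⅙ → ι k * (ι k * ½ ^ b) ≤ ⅙ →
    twoThirds ≤ accProb f (tester n k b r s m)
  completeness {n} {k} {b} {r} {s} {m} {f} ne (S , ∣S∣≤k , junta) 0<r many-steps few-clashes = ≤-trans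
    (≤-by (≤-trans (𝔼-collisions b S) (≤-trans (*-mono-≤ ∣S∣≤k) few-clashes)) total)
    (≤-trans (≤-reflexive (sym affine)) (≤-trans (mono vs pointwise) (≤-reflexive (sym (accProb-randomCubes f n b _)))))
    where
    vs = vecᴱ (cube n) b
    ⅚ : ℚ
    ⅚ = 1ℚ - ⅙
    *-mono-≤ : ∣ S ∣ ℕ.≤ k → ι ∣ S ∣ * (ι ∣ S ∣ * ½ ^ b) ≤ ι k * (ι k * ½ ^ b)
    *-mono-≤ le = ≤-trans (scale-≤ (0≤ι ∣ S ∣) inner) (*-monoʳ-≤-nonNeg _ {{nonNegative (0≤* (0≤ι k) (0≤^ 0≤½ b))}} (ι-mono le))
      where
      inner : ι ∣ S ∣ * ½ ^ b ≤ ι k * ½ ^ b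
      inner = *-monoʳ-≤-nonNeg (½ ^ b) {{nonNegative (0≤^ 0≤½ b)}} (ι-mono le)
    total : twoThirds + ⅙ ≡ (⅚ - 𝔼 vs (collisions S)) + 𝔼 vs (collisions S)
    total = step (𝔼 vs (collisions S))
      where
      step : ∀ x → twoThirds + ⅙ ≡ (⅚ - x) + x
      step x = sym (trans (+-assoc ⅚ (- x) x) (trans (cong (⅚ +_) (+-inverseˡ x)) refl))
    affine : 𝔼 vs (λ Ms → ⅚ - collisions S Ms) ≡ ⅚ - 𝔼 vs (collisions S)
    affine = trans (𝔼-cong vs λ Ms → step (collisions S Ms)) (trans (additive vs (λ _ → - ⅙) (λ Ms → 1ℚ - collisions S Ms))
      (trans (cong₂ _+_ (𝔼-const vs (- ⅙)) (𝔼-complement vs (collisions S))) (sym (step (𝔼 vs (collisions S))))))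
      where
      step : ∀ x → ⅚ - x ≡ - ⅙ + (1ℚ - x)
      step = solve-∀ ℚ-ring
    dep : DependsOn S f
    dep x y agree = junta x y λ i i∈ → agree i (∈⇒lookup i∈)
    pointwise : ∀ Ms → ⅚ - collisions S Ms ≤ accProb f (explore Ms r [] (verify k s m))
    pointwise Ms with collisions S Ms <? 1ℚ
    ... | no ≮ = ≤-trans (+-monoʳ-≤ ⅚ (neg-antimono-≤ (≮⇒≥ ≮)))
          (≤-trans (toWitness {a? = ⅚ - 1ℚ ≤? 0ℚ} tt) (accProb-≥0 ne (explore Ms r [] (verify k s m))))
    ... | yes lt = ≤-trans (≤-by (0≤collisions S Ms) (step ⅚ (collisions S Ms)))
          (0<⇒*-cancelˡ-≤ 0<r (≤-trans (≤-by (≤-trans (scale-≤ (0≤+ (0≤ι m) (0≤ι m)) (ι-mono start)) many-steps)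
              (regroup (ι r) ((ι m + ι m) * ι (remaining []))))
            (acceptance-≥-remaining r [] ([] , tt , start))))
      where
      open Explore f ne {S} dep {k} s m Ms (few-collisions⇒isolates S Ms lt)
      start : remaining [] ℕ.≤ k
      start = ℕ.≤-trans (ℕ.≤-reflexive (cong ∣_∣ (cube-id (v₀ :∩ :⊤) v₀ (S ∷ [])))) ∣S∣≤k
      step : ∀ a c → (a - c) + c ≡ a + 0ℚ
      step = solve-∀ ℚ-ring
      regroup : ∀ r x → r * ⅚ + r * ⅙ ≡ (r - x) + x
      regroup r x = trans (sym (*-distribˡ-+ r ⅚ ⅙)) (trans (*-identityʳ r) (sym (trans (+-assoc r (- x) x) (trans (cong (r +_) (+-inverseˡ x)) (+-identityʳ r)))))

  -- Number of calls

  maxList-map-≤ : ∀ {A : Set} (g : A → ℕ) {N} → (∀ x → g x ℕ.≤ N) → ∀ xs → maxList (map g xs) ℕ.≤ N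
  maxList-map-≤ g le []       = z≤n
  maxList-map-≤ g le (x ∷ xs) = ℕ.⊔-lub (le x) (maxList-map-≤ g le xs)

  -- A record, so that the algorithm can be inferred from the type of a bound on its cost.
  record _Costs_ {n} (A : Alg n) (N : ℕ) : Set where
    constructor costs
    field calls-≤ : calls A ℕ.≤ N

  open _Costs_

  cost-halt : ∀ {n} {b N} → halt {n} b Costs N
  cost-halt = costs z≤n

  cost-≤ : ∀ {n} {A : Alg n} {N N′} → N ℕ.≤ N′ → A Costs N → A Costs N′
  cost-≤ N≤N′ (costs le) = costs (ℕ.≤-trans le N≤N′)

  cost-sample : ∀ {n} {t : Cube n → Alg n} {N} → (∀ x → t x Costs N) → sample t Costs suc N
  cost-sample {n} {t} le = costs (s≤s (maxList-map-≤ (λ x → calls (t x)) (λ x → calls-≤ (le x)) (allPoints n)))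

  cost-query : ∀ {n x} {t : Bool → Alg n} {N} → (∀ b → t b Costs N) → query x t Costs suc N
  cost-query le = costs (s≤s (ℕ.⊔-lub (calls-≤ (le false)) (calls-≤ (le true))))

  cost-if : ∀ {n} b {t u : Alg n} {N} → t Costs N → u Costs N → (if b then t else u) Costs N
  cost-if false _ u = u
  cost-if true  t _ = t

  cost-randomCube : ∀ {n} m {t : Cube m → Alg n} {N} → (∀ z → t z Costs N) → randomCube m t Costs N
  cost-randomCube zero    le = le []
  cost-randomCube (suc m) le = costs (ℕ.⊔-lub
    (calls-≤ (cost-randomCube m (le ∘ (false ∷_)))) (calls-≤ (cost-randomCube m (le ∘ (true ∷_)))))

  cost-randomCubes : ∀ {n} m b {t : Vec (Cube m) b → Alg n} {N} → (∀ Ms → t Ms Costs N) → randomCubes m b t Costs N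
  cost-randomCubes m zero    le = le []
  cost-randomCubes m (suc b) le = cost-randomCube m λ M → cost-randomCubes m b (le ∘ (M ∷_))

  cost-checks : ∀ {n} s B O {t : Alg n} {N} → t Costs N → checks s B O t Costs (s ℕ.* 3 ℕ.+ N)
  cost-checks         zero    B O le = le
  cost-checks {n = n} (suc s) B O le = cost-randomCube n λ a → cost-randomCube n λ r →
    cost-query λ p → cost-query λ q → cost-query λ q′ →
    cost-if (not (p xor q) ∧ᵇ (p xor q′)) (cost-checks s B O le) cost-halt

  cost-probe : ∀ {n} s Bs Z W {t : Cube n → Alg n} {N} → (∀ W → t W Costs N) →
    probe s Bs Z W t Costs (length Bs ℕ.* (2 ℕ.+ s ℕ.* 3) ℕ.+ N)
  cost-probe s []       Z W le = le W
  cost-probe s (B ∷ Bs) Z W {N = N} le = cost-≤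
    (ℕ.≤-reflexive (cong (2 ℕ.+_) (sym (ℕ.+-assoc (s ℕ.* 3) (length Bs ℕ.* (2 ℕ.+ s ℕ.* 3)) N))))
    (cost-query λ p → cost-query λ q →
      cost-checks s B (side (p xor q) Z) (cost-probe s Bs Z (toggle (p xor q) (cell B) W) le))

  cost-verifyRounds : ∀ {n} s m (Bs : List (Block n)) →
    verifyRounds s m Bs Costs (m ℕ.* (length Bs ℕ.* (2 ℕ.+ s ℕ.* 3) ℕ.+ 2))
  cost-verifyRounds         s zero    Bs = cost-halt
  cost-verifyRounds {n = n} s (suc m) Bs = cost-≤
    (ℕ.≤-reflexive (sym (ℕ.+-assoc (length Bs ℕ.* (2 ℕ.+ s ℕ.* 3)) 2 _)))
    (cost-randomCube n λ Z → cost-probe s Bs Z Z λ W → cost-sample λ x → cost-query λ b →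
      cost-if b (cost-verifyRounds s m Bs) cost-halt)

  cost-verify : ∀ {n} k s m (Bs : List (Block n)) → verify k s m Bs Costs (m ℕ.* (k ℕ.* (2 ℕ.+ s ℕ.* 3) ℕ.+ 2))
  cost-verify k s m Bs = outcome (valid? k Bs)
    where
    outcome : (d : Dec (Valid k Bs)) → (if does d then verifyRounds s m Bs else halt false)
      Costs (m ℕ.* (k ℕ.* (2 ℕ.+ s ℕ.* 3) ℕ.+ 2))
    outcome (yes (len , _)) = cost-≤ (ℕ.*-monoʳ-≤ m (ℕ.+-monoˡ-≤ 2 (ℕ.*-monoˡ-≤ (2 ℕ.+ s ℕ.* 3) len)))
      (cost-verifyRounds s m Bs)
    outcome (no _) = cost-halt

  cost-search : ∀ {n b} (Ms : Vec (Cube n) b) x w X {t N} → (∀ B → t B Costs N) → search Ms x w X t Costs (b ℕ.+ N)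
  cost-search []       x w X le = le (block x X)
  cost-search (M ∷ Ms) x w X le = cost-query λ p → cost-if p
    (cost-search Ms (x ⊕ (w ∩ M)) (w ∩ ∁ M) (X ∩ ∁ M) le) (cost-search Ms x (w ∩ M) (X ∩ M) le)

  cost-explore : ∀ {n b} (Ms : Vec (Cube n) b) r Bs {t N} → (∀ Bs → t Bs Costs N) →
    explore Ms r Bs t Costs (r ℕ.* (2 ℕ.+ b) ℕ.+ N)
  cost-explore         Ms zero    Bs le = le Bs
  cost-explore {n} {b} Ms (suc r) Bs {N = N} le = cost-≤
    (ℕ.≤-reflexive (cong (2 ℕ.+_) (sym (ℕ.+-assoc b (r ℕ.* (2 ℕ.+ b)) N))))
    (cost-sample λ x → cost-randomCube n λ w → cost-query λ p → cost-if p
      (cost-≤ (ℕ.m≤n+m _ b) (cost-explore Ms r Bs le))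
      (cost-search Ms x (w ∩ free Bs) (free Bs) λ B → cost-explore Ms r (B ∷ Bs) le))

  cost-tester : ∀ n k b r s m →
    tester n k b r s m Costs (r ℕ.* (2 ℕ.+ b) ℕ.+ m ℕ.* (k ℕ.* (2 ℕ.+ s ℕ.* 3) ℕ.+ 2))
  cost-tester n k b r s m = cost-randomCubes n b λ Ms → cost-explore Ms r [] (cost-verify k s m)

  -- Ceilings, logarithms and the choice of parameters

  ι-reflects-≤ : ∀ {m n} → ι m ≤ ι n → m ℕ.≤ n
  ι-reflects-≤ {zero}          _  = z≤n
  ι-reflects-≤ {suc m} {zero}  le = ⊥-elim (<-irrefl refl (<-≤-trans (0<ι m) le))
  ι-reflects-≤ {suc m} {suc n} le = s≤s (ι-reflects-≤ (≤-by le (step (ι m) (ι n))))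
    where
    step : ∀ a b → a + (1ℚ + b) ≡ b + (1ℚ + a)
    step = solve-∀ ℚ-ring

  n≤2^⌈log₂n⌉ : ∀ n → n ℕ.≤ 2 ℕ.^ ⌈log₂ n ⌉
  n≤2^⌈log₂n⌉ = ℕ.<-rec (λ n → n ℕ.≤ 2 ℕ.^ ⌈log₂ n ⌉) step
    where
    step : ∀ n → (∀ {m} → m ℕ.< n → m ℕ.≤ 2 ℕ.^ ⌈log₂ m ⌉) → n ℕ.≤ 2 ℕ.^ ⌈log₂ n ⌉
    step zero          rec = z≤n
    step (suc zero)    rec = s≤s z≤n
    step n@(suc (suc n′)) rec = begin
      n                                     ≡⟨ sym (ℕ.⌊n/2⌋+⌈n/2⌉≡n n) ⟩
      ℕ.⌊ n /2⌋ ℕ.+ ℕ.⌈ n /2⌉               ≤⟨ ℕ.+-monoˡ-≤ ℕ.⌈ n /2⌉ (ℕ.⌊n/2⌋≤⌈n/2⌉ n) ⟩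
      ℕ.⌈ n /2⌉ ℕ.+ ℕ.⌈ n /2⌉               ≡⟨ cong (ℕ.⌈ n /2⌉ ℕ.+_) (sym (ℕ.+-identityʳ ℕ.⌈ n /2⌉)) ⟩
      2 ℕ.* ℕ.⌈ n /2⌉                       ≤⟨ ℕ.*-monoʳ-≤ 2 (rec (ℕ.⌈n/2⌉<n n′)) ⟩
      2 ℕ.* 2 ℕ.^ ⌈log₂ ℕ.⌈ n /2⌉ ⌉         ≡⟨ cong (λ l → 2 ℕ.* 2 ℕ.^ l) (⌈log₂⌈n/2⌉⌉≡⌈log₂n⌉∸1 n) ⟩
      2 ℕ.^ suc (⌈log₂ n ⌉ ℕ.∸ 1)           ≡⟨ cong (2 ℕ.^_) (ℕ.m+[n∸m]≡n {1} (⌈log₂⌉-mono-≤ {2} {n} (s≤s (s≤s z≤n)))) ⟩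
      2 ℕ.^ ⌈log₂ n ⌉                       ∎
      where open ℕ.≤-Reasoning

  ceilDiv-* : ∀ a d .{{_ : ℕ.NonZero d}} → a ℕ.≤ ceilDiv a d ℕ.* d
  ceilDiv-* a (suc d) = ℕ.+-cancelˡ-≤ d a _ (begin
    d ℕ.+ a                                        ≡⟨ ℕ.+-comm d a ⟩
    a ℕ.+ d                                        ≡⟨ ℕ.m≡m%n+[m/n]*n (a ℕ.+ d) (suc d) ⟩
    (a ℕ.+ d) ℕ.% suc d ℕ.+ ceilDiv a (suc d) ℕ.* suc d ≤⟨ ℕ.+-monoˡ-≤ _ (ℕ.≤-pred (ℕ.m%n<n (a ℕ.+ d) (suc d))) ⟩
    d ℕ.+ ceilDiv a (suc d) ℕ.* suc d              ∎)
    where open ℕ.≤-Reasoning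

  k≤ε*⌈k/ε⌉ : ∀ k ε → 0ℚ < ε → ι k ≤ ε * ι (ceilKOverEps k ε)
  k≤ε*⌈k/ε⌉ k ε@(mkℚ (ℤ.+ suc p) q-1 _) 0<ε = 0<⇒*-cancelˡ-≤ {c = ι q} (0<ι q-1) (≤-trans (≤-reflexive
      (trans (*-comm (ι q) (ι k)) (sym (ι-* k q))))
    (≤-trans (ι-mono (ceilDiv-* (k ℕ.* q) (suc p)))
    (≤-reflexive (trans (ι-* K (suc p)) (trans (cong (ι K *_) (sym ε*q)) (step (ι K) ε (ι q)))))))
    where
    q = suc q-1
    K = ceilKOverEps k ε
    ε*q : ε * ι q ≡ ι (suc p)
    ε*q = trans (cong (_* ι q) (sym (↥p/↧p≡p ε))) (frac-* (suc p) q)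
    step : ∀ K ε q → K * (ε * q) ≡ q * (ε * K)
    step = solve-∀ ℚ-ring
  k≤ε*⌈k/ε⌉ k (mkℚ (ℤ.+ zero) q-1 _) (*<* (ℤ.+<+ ()))
  k≤ε*⌈k/ε⌉ k (mkℚ (ℤ.-[1+ p ]) q-1 _) (*<* ())

  ^-≤½ : ∀ {p} n → 0ℚ ≤ p → p ≤ 1ℚ → 1ℚ ≤ ι n * (1ℚ - p) → p ^ n ≤ ½
  ^-≤½ {p} n 0≤p p≤1 le = 0<⇒*-cancelˡ-≤ {c = 1ℚ + 1ℚ} (positive⁻¹ (1ℚ + 1ℚ)) (≤-trans
    (≤-trans (≤-reflexive (*-comm (1ℚ + 1ℚ) (p ^ n))) (scale-≤ (0≤^ 0≤p n) (+-monoʳ-≤ 1ℚ le))) (bernoulli-upper 0≤p p≤1 n))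

  ½^-*-2^ : ∀ n → ½ ^ n * ι (2 ℕ.^ n) ≡ 1ℚ
  ½^-*-2^ n = trans (cong (½ ^ n *_) (ι-^ 2 n)) (trans (sym (*-^ ½ (ι 2) n)) (1^ n))

  -- Per unit of `m * k`, exploration costs 60 + 24ℓ and the probes 290 + 96ℓ; sample and last query
  -- of a round add 2. With `1 ≤ ℓ` the constants 352 join the 120 to give 472.
  total-calls : ∀ m k K ℓ .{{_ : ℕ.NonZero k}} → 1 ℕ.≤ ℓ → m ℕ.* k ℕ.≤ K ℕ.* 32 →
    12 ℕ.* (m ℕ.* k) ℕ.* (2 ℕ.+ (3 ℕ.+ (ℓ ℕ.+ ℓ))) ℕ.+ m ℕ.* (k ℕ.* (2 ℕ.+ (3 ℕ.+ ℓ) ℕ.* 32 ℕ.* 3) ℕ.+ 2)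
      ℕ.≤ (472 ℕ.* 32) ℕ.* (K ℕ.* ℓ)
  total-calls m k K ℓ 1≤ℓ m*k≤ = begin
    12 ℕ.* (m ℕ.* k) ℕ.* (5 ℕ.+ (ℓ ℕ.+ ℓ)) ℕ.+ m ℕ.* (k ℕ.* (2 ℕ.+ (3 ℕ.+ ℓ) ℕ.* 32 ℕ.* 3) ℕ.+ 2)
                                                       ≡⟨ expand m k ℓ ⟩
    (m ℕ.* k) ℕ.* (ℓ ℕ.* 120 ℕ.+ 350) ℕ.+ m ℕ.* 2
      ≤⟨ ℕ.+-monoʳ-≤ ((m ℕ.* k) ℕ.* (ℓ ℕ.* 120 ℕ.+ 350)) (ℕ.*-monoˡ-≤ 2 (ℕ.m≤m*n m k)) ⟩
    (m ℕ.* k) ℕ.* (ℓ ℕ.* 120 ℕ.+ 350) ℕ.+ m ℕ.* k ℕ.* 2 ≡⟨ sym (ℕ.*-distribˡ-+ (m ℕ.* k) (ℓ ℕ.* 120 ℕ.+ 350) 2) ⟩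
    (m ℕ.* k) ℕ.* (ℓ ℕ.* 120 ℕ.+ 350 ℕ.+ 2)            ≡⟨ cong ((m ℕ.* k) ℕ.*_) (ℕ.+-assoc (ℓ ℕ.* 120) 350 2) ⟩
    (m ℕ.* k) ℕ.* (ℓ ℕ.* 120 ℕ.+ 352)
      ≤⟨ ℕ.*-monoʳ-≤ (m ℕ.* k) (ℕ.+-monoʳ-≤ (ℓ ℕ.* 120) (ℕ.*-monoˡ-≤ 352 1≤ℓ)) ⟩
    (m ℕ.* k) ℕ.* (ℓ ℕ.* 120 ℕ.+ ℓ ℕ.* 352)            ≡⟨ cong ((m ℕ.* k) ℕ.*_) (sym (ℕ.*-distribˡ-+ ℓ 120 352)) ⟩
    (m ℕ.* k) ℕ.* (ℓ ℕ.* 472)                          ≤⟨ ℕ.*-monoˡ-≤ (ℓ ℕ.* 472) m*k≤ ⟩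
    (K ℕ.* 32) ℕ.* (ℓ ℕ.* 472)                         ≡⟨ regroup 32 K 472 ℓ ⟩
    (472 ℕ.* 32) ℕ.* (K ℕ.* ℓ)                         ∎
    where
    open ℕ.≤-Reasoning
    expand : ∀ m k ℓ → 12 ℕ.* (m ℕ.* k) ℕ.* (5 ℕ.+ (ℓ ℕ.+ ℓ)) ℕ.+ m ℕ.* (k ℕ.* (2 ℕ.+ (3 ℕ.+ ℓ) ℕ.* 32 ℕ.* 3) ℕ.+ 2)
                     ≡ (m ℕ.* k) ℕ.* (ℓ ℕ.* 120 ℕ.+ 350) ℕ.+ m ℕ.* 2
    expand = ℕ.solve-∀
    regroup : ∀ a b c d → (b ℕ.* a) ℕ.* (d ℕ.* c) ≡ (c ℕ.* a) ℕ.* (b ℕ.* d)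
    regroup = ℕ.solve-∀

  -- M ≥ 1/ε, so m is of order 1/ε; s makes each of the at most k blocks of a round err with probability
  -- at most ε/8k, and b makes the expected number of colliding pairs of relevant variables at most 1/6.
  module Parameters (k-1 : ℕ) (ε : ℚ) (0<ε : 0ℚ < ε) (ε<½ : ε < ½) where

    k K ℓ M m r b s : ℕ
    k   = suc k-1
    K   = ceilKOverEps k ε
    ℓ   = ⌈log₂ K ⌉
    -- Derived from `K` rather than from `ε`, so that `k * M` stays below `2 * K`.
    M   = suc (K ℕ./ k)
    -- A round rejects with probability at least ε/8, so the expected number of rejecting rounds is
    -- at least 2 and Bernoulli gives 1/(1 + 2).
    m   = 16 ℕ.* M
    -- The exploration loses `2 m k / r`, which becomes 1/6.
    r   = 12 ℕ.* (m ℕ.* k)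
    b   = 3 ℕ.+ (ℓ ℕ.+ ℓ)
    -- A batch of 32 = 1/δ checks halves the chance that a wrong answer survives.
    s   = (3 ℕ.+ ℓ) ℕ.* 32

    0≤ε : 0ℚ ≤ ε
    0≤ε = <⇒≤ 0<ε

    k≤εK : ι k ≤ ε * ι K
    k≤εK = k≤ε*⌈k/ε⌉ k ε 0<ε

    2k≤K : ι 2 * ι k ≤ ι K
    2k≤K = ≤-trans (scale-≤ (0≤ι 2) (≤-trans k≤εK (*-monoʳ-≤-nonNeg (ι K) {{nonNegative (0≤ι K)}} (<⇒≤ ε<½))))
      (≤-reflexive (trans (sym (*-assoc (ι 2) ½ (ι K))) (*-identityˡ (ι K))))

    k≤K : k ℕ.≤ K
    k≤K = ι-reflects-≤ (≤-trans (≤-by (0≤ι k) (step (ι k))) 2k≤K)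
      where
      step : ∀ x → x + x ≡ ι 2 * x + 0ℚ
      step = solve-∀ ℚ-ring

    -- `ε < ½` forces `K` to be at least 2; at `K` = 1 the logarithm, and with it the claimed bound
    -- on calls, would vanish.
    1≤ℓ : 1 ℕ.≤ ℓ
    1≤ℓ = ⌈log₂⌉-mono-≤ {2} {K} (ℕ.≤-trans (ℕ.*-monoʳ-≤ 2 (s≤s (z≤n {k-1})))
      (ι-reflects-≤ (≤-trans (≤-reflexive (ι-* 2 k)) 2k≤K)))

    K≤k*M : K ℕ.≤ k ℕ.* M
    K≤k*M = begin
      K                             ≡⟨ ℕ.m≡m%n+[m/n]*n K k ⟩
      K ℕ.% k ℕ.+ K ℕ./ k ℕ.* k     ≤⟨ ℕ.+-monoˡ-≤ _ (ℕ.<⇒≤ (ℕ.m%n<n K k)) ⟩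
      k ℕ.+ K ℕ./ k ℕ.* k           ≡⟨ ℕ.*-comm M k ⟩
      k ℕ.* M                       ∎
      where open ℕ.≤-Reasoning

    k*M≤2K : k ℕ.* M ℕ.≤ 2 ℕ.* K
    k*M≤2K = begin
      k ℕ.* M                       ≡⟨ ℕ.*-comm k M ⟩
      k ℕ.+ K ℕ./ k ℕ.* k           ≤⟨ ℕ.+-mono-≤ k≤K (ℕ.m/n*n≤m K k) ⟩
      K ℕ.+ K                       ≡⟨ cong (K ℕ.+_) (sym (ℕ.+-identityʳ K)) ⟩
      2 ℕ.* K                       ∎
      where open ℕ.≤-Reasoning

    1≤εM : 1ℚ ≤ ε * ι M
    1≤εM = 0<⇒*-cancelˡ-≤ {c = ι k} (0<ι k-1) (≤-trans (≤-reflexive (*-identityʳ (ι k)))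
      (≤-trans k≤εK (≤-trans (scale-≤ 0≤ε (≤-trans (ι-mono K≤k*M) (≤-reflexive (ι-* k M))))
        (≤-reflexive (step ε (ι k) (ι M))))))
      where
      step : ∀ e k M → e * (k * M) ≡ k * (e * M)
      step = solve-∀ ℚ-ring

    K/2^ℓ≤1 : ½ ^ ℓ * ι K ≤ 1ℚ
    K/2^ℓ≤1 = ≤-trans (scale-≤ (0≤^ 0≤½ ℓ) (ι-mono (n≤2^⌈log₂n⌉ K))) (≤-reflexive (½^-*-2^ ℓ))

    k/2^ℓ≤ε : ½ ^ ℓ * ι k ≤ ε
    k/2^ℓ≤ε = ≤-trans (scale-≤ (0≤^ 0≤½ ℓ) k≤εK) (≤-trans (≤-reflexive (step (½ ^ ℓ) ε (ι K)))
      (≤-trans (scale-≤ 0≤ε K/2^ℓ≤1) (≤-reflexive (*-identityʳ ε))))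
      where
      step : ∀ a b c → a * (b * c) ≡ b * (a * c)
      step = solve-∀ ℚ-ring

    escape : (1ℚ - δ) ^ s ≤ ½ ^ (3 ℕ.+ ℓ)
    escape = ≤-trans (≤-reflexive (^-* (1ℚ - δ) (3 ℕ.+ ℓ) 32))
      (^-mono (0≤^ 0≤1-δ 32) (^-≤½ 32 0≤1-δ (toWitness {a? = 1ℚ - δ ≤? 1ℚ} tt) (≤-reflexive refl)) (3 ℕ.+ ℓ))
      where
      0≤1-δ : 0ℚ ≤ 1ℚ - δ
      0≤1-δ = nonNegative⁻¹ (1ℚ - δ)

    ½^3+ : ∀ a → ½ ^ (3 ℕ.+ a) ≡ ⅛ * ½ ^ a
    ½^3+ a = ^-+ ½ 3 a

    escape≤¼ : (1ℚ - δ) ^ s ≤ ¼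
    escape≤¼ = ≤-trans escape (≤-trans (≤-reflexive (½^3+ ℓ))
      (≤-trans (scale-≤ (nonNegative⁻¹ ⅛) (^-≤1 0≤½ (toWitness {a? = ½ ≤? 1ℚ} tt) ℓ)) (toWitness {a? = ⅛ * 1ℚ ≤? ¼} tt)))

    k*escape : ι k * (1ℚ - δ) ^ s ≤ ⅛ * ε
    k*escape = ≤-trans (scale-≤ (0≤ι k) (≤-trans escape (≤-reflexive (½^3+ ℓ))))
      (≤-trans (≤-reflexive (step (ι k) (½ ^ ℓ))) (scale-≤ (nonNegative⁻¹ ⅛) k/2^ℓ≤ε))
      where
      step : ∀ k h → k * (⅛ * h) ≡ ⅛ * (h * k)
      step = solve-∀ ℚ-ring

    few-clashes : ι k * (ι k * ½ ^ b) ≤ ⅙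
    few-clashes = ≤-trans (≤-reflexive (trans
        (cong (λ x → ι k * (ι k * x)) (trans (½^3+ (ℓ ℕ.+ ℓ)) (cong (⅛ *_) (^-+ ½ ℓ ℓ))))
        (step (ι k) (½ ^ ℓ))))
      (≤-trans (scale-≤ (nonNegative⁻¹ ⅛) (*-≤1 (0≤* (0≤^ 0≤½ ℓ) (0≤ι k)) k/2^ℓ≤1 k/2^ℓ≤1)) (toWitness {a? = ⅛ * 1ℚ ≤? ⅙} tt))
      where
      step : ∀ k h → k * (k * (⅛ * (h * h))) ≡ ⅛ * ((h * k) * (h * k))
      step = solve-∀ ℚ-ring
      k/2^ℓ≤1 : ½ ^ ℓ * ι k ≤ 1ℚ
      k/2^ℓ≤1 = ≤-trans (scale-≤ (0≤^ 0≤½ ℓ) (ι-mono k≤K)) K/2^ℓ≤1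

    many-steps : (ι m + ι m) * ι k ≤ ι r * ⅙
    many-steps = ≤-reflexive (sym (trans (cong (_* ⅙) (trans (ι-* 12 (m ℕ.* k)) (cong (ι 12 *_) (ι-* m k)))) (step (ι m) (ι k))))
      where
      step : ∀ m k → ι 12 * (m * k) * ⅙ ≡ (m + m) * k
      step = solve-∀ ℚ-ring

    rounds-reject : ∀ {x} → 0ℚ ≤ x → x ≤ 1ℚ - ⅛ * ε → x ^ m ≤ ⅓
    rounds-reject {x} 0≤x x≤ = 0<⇒*-cancelˡ-≤ {c = ι 3} (positive⁻¹ (ι 3)) (≤-trans
      (≤-trans (≤-reflexive (*-comm (ι 3) (x ^ m))) (scale-≤ (0≤^ 0≤x m) 3≤)) (bernoulli-upper 0≤x x≤1 m))
      where
      x≤1 : x ≤ 1ℚ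
      x≤1 = ≤-trans x≤ (≤-by (0≤* (nonNegative⁻¹ ⅛) 0≤ε) (step ε))
        where
        step : ∀ e → (1ℚ - ⅛ * e) + ⅛ * e ≡ 1ℚ + 0ℚ
        step = solve-∀ ℚ-ring
      3≤ : ι 3 ≤ 1ℚ + ι m * (1ℚ - x)
      3≤ = ≤-by (+-mono-≤ (scale-≤ (0≤ι m) x≤) (scale-≤ (0≤ι 2) 1≤εM))
        (trans (cong (λ μ → ι 3 + (μ * (1ℚ - ⅛ * ε) + ι 2 * (ε * ι M))) (ι-* 16 M))
          (trans (step (ι M) ε x) (cong (λ μ → 1ℚ + μ * (1ℚ - x) + (μ * x + ι 2 * 1ℚ)) (sym (ι-* 16 M)))))
        where
        step : ∀ M e x → ι 3 + (ι 16 * M * (1ℚ - ⅛ * e) + ι 2 * (e * M))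
                       ≡ 1ℚ + ι 16 * M * (1ℚ - x) + (ι 16 * M * x + ι 2 * 1ℚ)
        step = solve-∀ ℚ-ring

    tester-calls : ∀ n → calls (tester n k b r s m) ℕ.≤ (472 ℕ.* 32) ℕ.* (K ℕ.* ℓ)
    tester-calls n = ℕ.≤-trans (calls-≤ (cost-tester n k b r s m)) (total-calls m k K ℓ 1≤ℓ m*k≤)
      where
      open ℕ.≤-Reasoning
      m*k≤ : m ℕ.* k ℕ.≤ K ℕ.* 32
      m*k≤ = begin
        16 ℕ.* M ℕ.* k      ≡⟨ ℕ.*-assoc 16 M k ⟩
        16 ℕ.* (M ℕ.* k)    ≡⟨ cong (16 ℕ.*_) (ℕ.*-comm M k) ⟩
        16 ℕ.* (k ℕ.* M)    ≤⟨ ℕ.*-monoʳ-≤ 16 k*M≤2K ⟩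
        16 ℕ.* (2 ℕ.* K)    ≡⟨ sym (ℕ.*-assoc 16 2 K) ⟩
        32 ℕ.* K            ≡⟨ ℕ.*-comm 32 K ⟩
        K ℕ.* 32            ∎

    accepts : ∀ {n} {f : BoolFun n} → Nonempty f → IsJunta k f → twoThirds ≤ accProb f (tester n k b r s m)
    accepts {n} {f} ne junta = completeness {n} {k} {b} {r} {s} {m} ne junta (0<ι (ℕ.pred r)) many-steps few-clashes

    rejects : ∀ {n} {f : BoolFun n} → Nonempty f → Far k ε f → twoThirds ≤ 1ℚ - accProb f (tester n k b r s m)
    rejects {n} {f} ne far = +-monoʳ-≤ 1ℚ (neg-antimono-≤ (soundness {n} {k} {b} {r} {s} {m} ne (nonNegative⁻¹ ⅓) λ Bs valid →
      rounds-reject (0≤roundRate ne s Bs)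
        (far-roundRate ne far (≤-trans (<⇒≤ ε<½) (toWitness {a? = ½ ≤? 1ℚ} tt)) escape≤¼ k*escape Bs valid)))

  tester-exists : ∃[ C ] ∀ k → 1 ℕ.≤ k → ∀ ε → 0ℚ < ε → ε < ½ → ∀ n →
    ∃[ A ] (calls {n} A ℕ.≤ C ℕ.* bound k ε ×
      (∀ f → Nonempty f → (IsJunta k f → twoThirds ≤ accProb f A) × (Far k ε f → twoThirds ≤ 1ℚ - accProb f A)))
  tester-exists = 472 ℕ.* 32 , λ { (suc k-1) _ ε 0<ε ε<½ n → let open Parameters k-1 ε 0<ε ε<½ in
    tester n k b r s m , tester-calls n , λ f ne → accepts ne , rejects ne }

open import Data.Nat using (ℕ; _*_; _≤_)
open import Data.Rational using (ℚ; 0ℚ; 1ℚ; ½; _<_; _-_) renaming (_≤_ to _≤ℚ_)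
open import Data.Product using (_×_; ∃-syntax)

theorem1p1 : ∃[ C ] ∀ (k : ℕ) → 1 ≤ k → ∀ (ε : ℚ) → 0ℚ < ε → ε < ½ → ∀ (n : ℕ) →
    ∃[ A ] ((calls {n} A ≤ C * bound k ε) ×
    (∀ (f : BoolFun n) → Nonempty f →
    (IsJunta k f → twoThirds ≤ℚ accProb f A) ×
    ((∀ (g : BoolFun n) → IsJunta k g → ε ≤ℚ relDist f g) → twoThirds ≤ℚ (1ℚ - accProb f A))))
theorem1p1 = JuntaTester.tester-exists
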